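{- Let $p$ be a prime, and let $a,n\in\mathbb Z^+$, $l\in\mathbb N$ and $r\in\mathbb Z$. Then $$\mathrm{ord}_p\left(\left\{\begin{matrix} pn\\ pr\end{matrix}\right\}_{l,p^{a+1}}-\left\{\begin{matrix} n\\ r\end{matrix}\right\}_{l,p^{a}}\right)\geqslant\frac{p-1}p\bigl(2\,\mathrm{ord}_p(n)+\delta\bigr),$$ where $\delta=0$ if $p=2$, $\delta=1$ if $p=3$, and $\delta=2$ if $p\geqslant5$.
   Context: $\mathbb N=\{0,1,2,\ldots\}$; $\mathrm{ord}_p(x)=\sup\{m\in\mathbb N: p^m\mid x\}$ (so $\mathrm{ord}_p(0)=\infty$). Binomial coefficients: $\binom x0=1$, $\binom xk=x(x-1)\cdots(x-k+1)/k!$ for $k\in\mathbb Z^+$ (for rational $x$), and $\binom xk=0$ for negative integers $k$. For a prime $p$, $b\in\mathbb Z^+$, $l,n\in\mathbb N$ and $r\in\mathbb Z$, $$\left\{\begin{matrix} n\\ r\end{matrix}\right\}_{l,p^{b}}:=p^{ -\left\lfloor\frac{n-p^{b-1}-lp^{b}}{\phi(p^{b})}\right\rfloor}\sum_{k\equiv r\,(\mathrm{mod}\ p^{b})}(-1)^k\binom nk\binom{(k-r)/p^{b}}l,$$ the sum over all integers $k\equiv r\pmod{p^b}$, with $\phi$ Euler's totient function. These numbers are integers. -}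

module Defs where

open import Data.Nat as ℕ using (ℕ; zero; suc; _∸_; _!)
open import Data.Nat.Combinatorics using (_C_)
open import Data.Nat.GCD using (gcd)
open import Data.Integer as ℤ using (ℤ; +_; -[1+_]; _-_; _*_; -_; _/ℕ_)
open import Data.Integer.Divisibility using (_∣_)
open import Data.List using (List; upTo; map; foldr; filter; length)
open import Data.Bool using (if_then_else_)
open import Data.Product using (_×_)
open import Relation.Nullary using (¬_)
open import Relation.Nullary.Decidable using (does)

totient : ℕ → ℕ
totient m = length (filter (λ k → gcd (suc k) m ℕ.≟ 1) (upTo m))

-- Floor division of an integer by a natural number (d = 0 gives 0; never
-- used with d = 0 below).
floorDiv : ℤ → ℕ → ℤ
floorDiv x zero    = + 0
floorDiv x (suc d) = x /ℕ suc d

falling : ℤ → ℕ → ℤ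
falling x zero    = + 1
falling x (suc k) = falling x k * (x - + k)

-- Binomial coefficient binom(x,k) = x(x-1)…(x-k+1)/k! for integer x and
-- k ∈ ℕ (the division is exact).
binomℤ : ℤ → ℕ → ℤ
binomℤ x k = floorDiv (falling x k) (k !)

-- p^{-e} · S for an integer exponent e.  For e = m ≥ 0 this is the
-- quotient S / p^m (exact in all uses: the paper notes these numbers are
-- integers); for e < 0 it is S · p^{-e}.
scaleNegPow : ℕ → ℤ → ℤ → ℤ
scaleNegPow p (+ m)    S = floorDiv S (p ℕ.^ m)
scaleNegPow p -[1+ m ] S = S * + (p ℕ.^ suc m)

summand : ℕ → ℕ → ℕ → ℕ → ℤ → ℕ → ℤ
summand p b l n r k =
  if does (x - q * + pb ℤ.≟ + 0)
  then (- + 1) ℤ.^ k * + (n C k) * binomℤ q l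
  else + 0
  where
  pb = p ℕ.^ b
  x  = + k - r
  q  = floorDiv x pb

-- The sum over all integers k ≡ r (mod p^b) of (-1)^k binom(n,k)
-- binom((k-r)/p^b, l); binom(n,k) = 0 unless 0 ≤ k ≤ n, so only
-- k ∈ {0,…,n} contribute.
bracketSum : ℕ → ℕ → ℕ → ℕ → ℤ → ℤ
bracketSum p b l n r = foldr ℤ._+_ (+ 0) (map (summand p b l n r) (upTo (suc n)))

-- { n \brace r }_{l,p^b}  (for b ≥ 1)
bracket : ℕ → ℕ → ℕ → ℕ → ℤ → ℤ
bracket p b l n r =
  scaleNegPow p
    (floorDiv (+ n - + (p ℕ.^ (b ∸ 1)) - + (l ℕ.* p ℕ.^ b)) (totient (p ℕ.^ b)))
    (bracketSum p b l n r)

-- ord_p(x) = v  (x ≠ 0): p^v ∣ x and p^(v+1) ∤ x.  (For x = 0 there is no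
-- such v, matching ord_p(0) = ∞.)
IsOrd : ℕ → ℤ → ℕ → Set
IsOrd p x v = (+ (p ℕ.^ v) ∣ x) × ¬ (+ (p ℕ.^ suc v) ∣ x)

δ : ℕ → ℕ
δ 2 = 0
δ 3 = 1
δ _ = 2

{-# OPTIONS --safe #-}
module Submission where

-- Write ord for ord_p, D_j = (−1)^{pj} C(pn,pj) − (−1)^j C(n,j), and let F be
-- the function x ↦ binom((x−r)/p^a, l) on x ≡ r (mod p^a), zero elsewhere.
-- Both brackets carry the same power of p, and substituting k = pj shows that
-- their sums differ by Σ_j D_j F(j).  By Newton's formula
-- F(j) = Σ_m C(j,m) Δ^m F(0) this is Σ_m c_m Δ^m F(0), c_m = Σ_j D_j C(j,m).
--
-- (1) p^t divides Δ^m F as soon as φ(p^a) t + p^{a−1} + l p^a ≤ m (Weisman,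
--     Wan): modulo p the power (x−1)^{φ(p^a)} of Δ = x − 1 is the cyclotomic
--     polynomial Φ, while Φ² ≡ p Φ modulo x^{p^a} − 1, which lowers l by one.
-- (2) p^{2 ord(n) + δ + 1} divides every D_j: a Wolstenholme-type congruence,
--     from pairing the factors u and pj − u of (pj)! that are prime to p.
-- (3) For m < n the C(n,j) part of c_m is an n-th difference of a polynomial
--     of degree m, so it vanishes, and c_m is a bracket sum modulo p; hence
--     p^t divides c_m as soon as (p−1) t + 1 ≤ p (n−m), by (1).
--
-- With d = n − m, the bound (1) for Δ^m F loses at most ⌈d/(p−1)⌉ against the
-- exponent in the brackets.  For small d the loss is made up by (2) and for
-- large d by (3); the two balance at (p−1)/p · (2 ord(n) + δ).

open import Defs
open import Level using (0ℓ)
open import Algebra.Bundles using (CommutativeSemiring)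
open import Algebra.Structures.Biased using (isCommutativeSemiringˡ)
open import Data.Bool.Base using (Bool; true; false; if_then_else_)
open import Data.Empty using (⊥-elim)
open import Data.Integer.Divisibility.Signed using (∣ᵤ⇒∣; ∣⇒∣ᵤ)
import Data.Integer.Properties as ℤ
import Data.Integer.Tactic.RingSolver as ℤ-Ring
open import Data.List.Base using (filter; foldr; length; map; applyUpTo; upTo)
open import Data.List.Properties using (map-upTo)
open import Data.Nat.Base as ℕ using (ℕ; zero; suc; z≤n; s≤s; NonZero; _!)
open import Data.Nat.Combinatorics
  using (_C_; nCk+nC[k+1]≡[n+1]C[k+1]; nCk≡nC[n∸k]; nCk≡n!/k![n-k]!; nCn≡1; nC1≡n; k![n∸k]!∣n!)
open import Data.Nat.Combinatorics.Specification using (k>n⇒nCk≡0)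
open import Data.Nat.Coprimality using (Coprime; coprime-divisor; coprime⇒gcd≡1)
open import Data.Nat.DivMod using (m≡m%n+[m/n]*n; m%n<n; m/n*n≡m)
import Data.Nat.Divisibility as ℕ∣
open import Data.Nat.GCD using (gcd; gcd-greatest)
open import Data.Nat.Primality
  using (Prime; prime⇒nonZero; prime⇒irreducible; euclidsLemma; ¬prime[0]; ¬prime[1])
import Data.Nat.Properties as ℕ
import Data.Nat.Tactic.RingSolver as ℕ-Ring
open import Data.Product.Base using (∃; _,_; _×_; proj₁; proj₂)
open import Data.Sum.Base as Sum using (_⊎_; inj₁; inj₂)
open import Function.Base using (_∘_; it)
open import Relation.Binary.PropositionalEquality
  using (_≡_; refl; sym; trans; cong; cong₂; subst; module ≡-Reasoning)
open import Relation.Binary.Structures using (IsEquivalence)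
open import Relation.Nullary using (¬_; yes; no; does)
open import Relation.Nullary.Decidable using (dec-true; dec-false)
open import Relation.Unary using (Decidable)

-- The claim is proved by contradiction. Let K = 2 ord(n) + δ, suppose p v < (p-1) K, and let g =
-- ⌈d/(p-1)⌉ be the loss at m = n - d. It suffices that p^{v+1+g} divides c_m. For d ≥ v + 2 this is
-- within reach of (3). For d ≤ v + 1, (p-1)(v+g) < (p-1)v + d + (p-1) ≤ (p v + 1) + (p-1) ≤
-- (p-1)(K+1), so v + 1 + g ≤ K + 1 and (2) suffices. The factor (p-1)/p comes from comparing p v
-- with (p-1) K here. The polynomial algebra lives in commutative semirings. Congruences are
-- therefore written additively, as f ≈ g + p h with a witness h, and subtraction enters only when
-- divisibility of integers is cancelled. Wherever the prime is written `suc p`, the variable `p` is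
-- the prime minus one. Beside it `q` is the prime in the parts on blocks and on bracket sums, but
-- the modulus, a power of the prime, in `U q l` and in (1).

C-absorb : ∀ n k → suc k ℕ.* (suc n C suc k) ≡ suc n ℕ.* (n C k)
C-absorb zero    zero    = refl
C-absorb zero    (suc k) = begin
  suc (suc k) ℕ.* (1 C suc (suc k)) ≡⟨ cong (suc (suc k) ℕ.*_) (k>n⇒nCk≡0 {1} {suc (suc k)} (s≤s (s≤s z≤n))) ⟩
  suc (suc k) ℕ.* 0                 ≡⟨ ℕ.*-zeroʳ (suc (suc k)) ⟩
  1 ℕ.* 0                           ≡⟨ cong (1 ℕ.*_) (k>n⇒nCk≡0 {0} {suc k} (s≤s z≤n)) ⟨
  1 ℕ.* (0 C suc k)                 ∎
  where open ≡-Reasoning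
C-absorb (suc n) zero    = begin
  1 ℕ.* (suc (suc n) C 1)   ≡⟨ cong (1 ℕ.*_) (nC1≡n (suc (suc n))) ⟩
  1 ℕ.* suc (suc n)         ≡⟨ ℕ.*-comm 1 (suc (suc n)) ⟩
  suc (suc n) ℕ.* 1         ∎
  where open ≡-Reasoning
C-absorb (suc n) (suc k) = begin
  suc (suc k) ℕ.* (suc (suc n) C suc (suc k))
    ≡⟨ cong (suc (suc k) ℕ.*_) (nCk+nC[k+1]≡[n+1]C[k+1] (suc n) (suc k)) ⟨
  suc (suc k) ℕ.* (a ℕ.+ b)
    ≡⟨ lem₁ k a b ⟩
  suc k ℕ.* a ℕ.+ a ℕ.+ suc (suc k) ℕ.* b
    ≡⟨ cong₂ (λ x y → x ℕ.+ a ℕ.+ y) (C-absorb n k) (C-absorb n (suc k)) ⟩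
  suc n ℕ.* c ℕ.+ a ℕ.+ suc n ℕ.* d
    ≡⟨ lem₂ n a c d ⟩
  suc n ℕ.* (c ℕ.+ d) ℕ.+ a
    ≡⟨ cong (λ x → suc n ℕ.* x ℕ.+ a) (nCk+nC[k+1]≡[n+1]C[k+1] n k) ⟩
  suc n ℕ.* a ℕ.+ a
    ≡⟨ ℕ.+-comm (suc n ℕ.* a) a ⟩
  suc (suc n) ℕ.* a ∎
  where
  open ≡-Reasoning
  a b c d : ℕ
  a = suc n C suc k
  b = suc n C suc (suc k)
  c = n C k
  d = n C suc k
  lem₁ : ∀ k a b → suc (suc k) ℕ.* (a ℕ.+ b) ≡ suc k ℕ.* a ℕ.+ a ℕ.+ suc (suc k) ℕ.* b
  lem₁ = ℕ-Ring.solve-∀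
  lem₂ : ∀ n a c d → suc n ℕ.* c ℕ.+ a ℕ.+ suc n ℕ.* d ≡ suc n ℕ.* (c ℕ.+ d) ℕ.+ a
  lem₂ = ℕ-Ring.solve-∀

[k+1]*[j+k+1]Cj : ∀ j k → suc k ℕ.* ((j ℕ.+ suc k) C j) ≡ (j ℕ.+ suc k) ℕ.* ((j ℕ.+ k) C j)
[k+1]*[j+k+1]Cj j k = begin
  suc k ℕ.* ((j ℕ.+ suc k) C j)         ≡⟨ cong (suc k ℕ.*_) (flip j (suc k)) ⟩
  suc k ℕ.* ((j ℕ.+ suc k) C suc k)     ≡⟨ cong (λ m → suc k ℕ.* (m C suc k)) (ℕ.+-suc j k) ⟩
  suc k ℕ.* (suc (j ℕ.+ k) C suc k)     ≡⟨ C-absorb (j ℕ.+ k) k ⟩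
  suc (j ℕ.+ k) ℕ.* ((j ℕ.+ k) C k)     ≡⟨ cong₂ ℕ._*_ (ℕ.+-suc j k) (flip j k) ⟨
  (j ℕ.+ suc k) ℕ.* ((j ℕ.+ k) C j)     ∎
  where
  open ≡-Reasoning
  flip : ∀ j k → (j ℕ.+ k) C j ≡ (j ℕ.+ k) C k
  flip j k = trans (nCk≡nC[n∸k] (ℕ.m≤m+n j k)) (cong ((j ℕ.+ k) C_) (ℕ.m+n∸m≡n j k))

p∣pCk : ∀ {p} → Prime p → ∀ k → suc k ℕ.< p → p ℕ∣.∣ p C suc k
p∣pCk {suc p} pr k k<p with euclidsLemma (suc k) (suc p C suc k) pr
                              (subst (suc p ℕ∣.∣_) (sym (C-absorb p k)) (ℕ∣.m∣m*n (p C k)))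
... | inj₁ p∣k = ⊥-elim (ℕ.<⇒≱ k<p (ℕ∣.∣⇒≤ p∣k))
... | inj₂ p∣C = p∣C

-- Polynomials with natural coefficients and the cyclotomic factors of x^{p^b} - 1.

module BinomialSeries {c ℓ} (R : CommutativeSemiring c ℓ) where

  open CommutativeSemiring R hiding (sym; trans; refl)
  private module R = CommutativeSemiring R
  open import Algebra.Properties.Semiring.Mult semiring
    using (×-homo-+; ×-homo-1; ×1-homo-*; ×-congˡ) renaming (_×_ to _·_)
  open import Algebra.Properties.Semiring.Exp semiring using (_^_; ^-congˡ; ^-assocʳ)
  open import Algebra.Solver.Ring.NaturalCoefficients.Default R
    using (solve; _:=_; _:+_; _:*_)
  open import Relation.Binary.Reasoning.Setoid setoid

  -- Horner form of a polynomial with N coefficients. Natural coefficients make sense in every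
  -- semiring, so the same algebra serves ℤ and the shift operators.
  evl : ℕ → (ℕ → ℕ) → Carrier → Carrier
  evl zero    c z = 0#
  evl (suc N) c z = c 0 · 1# + z * evl N (c ∘ suc) z

  evl-cong : ∀ N {c d : ℕ → ℕ} z → (∀ k → c k ≡ d k) → evl N c z ≈ evl N d z
  evl-cong zero    z c≡d = R.refl
  evl-cong (suc N) z c≡d =
    +-cong (×-congˡ (c≡d 0)) (*-congˡ (evl-cong N z (c≡d ∘ suc)))

  evl-+ : ∀ N (c d : ℕ → ℕ) z → evl N (λ k → c k ℕ.+ d k) z ≈ evl N c z + evl N d z
  evl-+ zero    c d z = R.sym (+-identityˡ 0#)
  evl-+ (suc N) c d z = begin
    (c 0 ℕ.+ d 0) · 1# + z * evl N (λ k → c (suc k) ℕ.+ d (suc k)) z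
      ≈⟨ +-cong (×-homo-+ 1# (c 0) (d 0)) (*-congˡ (evl-+ N (c ∘ suc) (d ∘ suc) z)) ⟩
    (c 0 · 1# + d 0 · 1#) + z * (evl N (c ∘ suc) z + evl N (d ∘ suc) z)
      ≈⟨ solve 5 (λ a b z e f → (a :+ b) :+ z :* (e :+ f) := (a :+ z :* e) :+ (b :+ z :* f))
           R.refl (c 0 · 1#) (d 0 · 1#) z (evl N (c ∘ suc) z) (evl N (d ∘ suc) z) ⟩
    (c 0 · 1# + z * evl N (c ∘ suc) z) + (d 0 · 1# + z * evl N (d ∘ suc) z) ∎

  evl-zero : ∀ N {c : ℕ → ℕ} z → (∀ k → c k ≡ 0) → evl N c z ≈ 0#
  evl-zero zero    z c≡0 = R.refl
  evl-zero (suc N) z c≡0 = begin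
    _ ≈⟨ +-cong (×-congˡ (c≡0 0)) (*-congˡ (evl-zero N z (c≡0 ∘ suc))) ⟩
    0# + z * 0#  ≈⟨ +-identityˡ _ ⟩
    z * 0#       ≈⟨ zeroʳ z ⟩
    0#           ∎

  evl-extend : ∀ {N M} {c : ℕ → ℕ} z → N ℕ.≤ M → (∀ k → N ℕ.≤ k → c k ≡ 0) →
               evl M c z ≈ evl N c z
  evl-extend {M = M} z z≤n       c≡0 = evl-zero M z (λ k → c≡0 k z≤n)
  evl-extend         z (s≤s N≤M) c≡0 =
    +-congˡ (*-congˡ (evl-extend z N≤M (λ k N≤k → c≡0 (suc k) (s≤s N≤k))))

  evl-binomial : ∀ n z → evl (suc n) (n C_) z ≈ (1# + z) ^ n
  evl-binomial zero    z = begin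
    (1# + 0#) + z * 0# ≈⟨ +-cong (+-identityʳ 1#) (zeroʳ z) ⟩
    1# + 0#            ≈⟨ +-identityʳ 1# ⟩
    1#                 ∎
  evl-binomial (suc n) z = begin
    1 · 1# + z * evl (suc n) (λ k → suc n C suc k) z
      ≈⟨ +-congˡ (*-congˡ (evl-cong (suc n) z (λ k → sym (nCk+nC[k+1]≡[n+1]C[k+1] n k)))) ⟩
    1 · 1# + z * evl (suc n) (λ k → n C k ℕ.+ n C suc k) z
      ≈⟨ +-congˡ (*-congˡ (evl-+ (suc n) (n C_) (λ k → n C suc k) z)) ⟩
    1 · 1# + z * (B + evl (suc n) (λ k → n C suc k) z)
      ≈⟨ +-congˡ (*-congˡ (+-congˡ (evl-extend z (ℕ.n≤1+n n) (λ k n≤k → k>n⇒nCk≡0 (s≤s n≤k))))) ⟩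
    1 · 1# + z * (B + evl n (λ k → n C suc k) z)
      ≈⟨ solve 4 (λ o z b e → o :+ z :* (b :+ e) := (o :+ z :* e) :+ z :* b) R.refl (1 · 1#) z B _ ⟩
    B + z * B
      ≈⟨ +-congʳ (R.sym (*-identityˡ B)) ⟩
    1# * B + z * B
      ≈⟨ distribʳ B 1# z ⟨
    (1# + z) * B
      ≈⟨ *-congˡ (evl-binomial n z) ⟩
    (1# + z) * (1# + z) ^ n ∎
    where
    B : Carrier
    B = evl (suc n) (n C_) z

  -- Eisenstein shape: each coefficient below the leading one adds a multiple of p, collected in the
  -- witness g.
  evl-leading : ∀ {p} n {c : ℕ → ℕ} z → (∀ k → k ℕ.< n → p ℕ∣.∣ c k) → c n ≡ 1 →
                ∃ λ g → evl (suc n) c z ≈ z ^ n + (p · 1#) * g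
  evl-leading {p} zero {c} z p∣c c≡1 = 0# , (begin
    c 0 · 1# + z * 0#   ≈⟨ +-cong (×-congˡ c≡1) (zeroʳ z) ⟩
    1 · 1# + 0#         ≈⟨ +-congʳ (×-homo-1 1#) ⟩
    1# + 0#             ≈⟨ +-congˡ (zeroʳ (p · 1#)) ⟨
    1# + (p · 1#) * 0#  ∎)
  evl-leading {p} (suc n) {c} z p∣c c≡1
    with p∣c 0 (s≤s z≤n) | evl-leading {p} n {c ∘ suc} z (λ k k<n → p∣c (suc k) (s≤s k<n)) c≡1
  ... | ℕ∣.divides q c0≡qp | g , eq = q · 1# + z * g , (begin
    c 0 · 1# + z * evl (suc n) (c ∘ suc) z
      ≈⟨ +-cong (R.trans (×-congˡ c0≡qp) (×1-homo-* q p)) (*-congˡ eq) ⟩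
    (q · 1#) * (p · 1#) + z * (z ^ n + (p · 1#) * g)
      ≈⟨ solve 5 (λ q p z y g → q :* p :+ z :* (y :+ p :* g) := z :* y :+ p :* (q :+ z :* g))
           R.refl (q · 1#) (p · 1#) z (z ^ n) g ⟩
    z * z ^ n + (p · 1#) * (q · 1# + z * g) ∎)

  -- z Ψ(z) = (1 + z)^p − 1; applied to z = x^{p^{b-1}} − 1 this is the
  -- factorisation of x^{p^b} − 1 through the p^b-th cyclotomic polynomial.
  Ψ : ℕ → Carrier → Carrier
  Ψ p = evl p (λ k → p C suc k)

  Ψ-factor : ∀ p z → (1# + z) ^ p ≈ 1# + z * Ψ p z
  Ψ-factor p z = begin
    (1# + z) ^ p       ≈⟨ evl-binomial p z ⟨
    1 · 1# + z * Ψ p z ≈⟨ +-congʳ (×-homo-1 1#) ⟩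
    1# + z * Ψ p z     ∎

  -- The constant term is C(p,1) = p. With z = x^{p^b} - 1 and Φ = Ψ(z) this yields Φ² = p Φ + h z
  -- Φ, where z Φ = x^{p^{b+1}} - 1.
  Ψ-constant : ∀ p .{{_ : NonZero p}} z → ∃ λ h → Ψ p z ≈ p · 1# + z * h
  Ψ-constant (suc p) z = _ , +-congʳ (×-congˡ (nC1≡n (suc p)))

  Ψ-leading : ∀ {p} → Prime (suc p) → ∀ z → ∃ λ g → Ψ (suc p) z ≈ z ^ p + (suc p · 1#) * g
  Ψ-leading {p} pr z = evl-leading p z (λ k k<p → p∣pCk pr k (s≤s k<p)) (nCn≡1 (suc p))

  ^-mod : ∀ p {a b g} n → a ≈ b + (p · 1#) * g → ∃ λ h → a ^ n ≈ b ^ n + (p · 1#) * h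
  ^-mod p zero eq = 0# , (begin
    1#                  ≈⟨ +-identityʳ 1# ⟨
    1# + 0#             ≈⟨ +-congˡ (zeroʳ (p · 1#)) ⟨
    1# + (p · 1#) * 0#  ∎)
  ^-mod p {a} {b} {g} (suc n) eq with ^-mod p n eq
  ... | h , eq′ = b * h + g * b ^ n + (p · 1#) * (g * h) , (begin
    a * a ^ n
      ≈⟨ *-cong eq eq′ ⟩
    (b + (p · 1#) * g) * (b ^ n + (p · 1#) * h)
      ≈⟨ solve 5 (λ b c p g h → (b :+ p :* g) :* (c :+ p :* h) := b :* c :+ p :* (b :* h :+ g :* c :+ p :* (g :* h)))
           R.refl b (b ^ n) (p · 1#) g h ⟩
    b * b ^ n + (p · 1#) * (b * h + g * b ^ n + (p · 1#) * (g * h)) ∎)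

  -- With x = 1 + z this is x^{p^b} - 1, written as a product for want of subtraction. By definition
  -- it is its predecessor times `Φ`.
  iterate-Ψ : ℕ → Carrier → ℕ → Carrier
  iterate-Ψ p z zero    = z
  iterate-Ψ p z (suc b) = iterate-Ψ p z b * Ψ p (iterate-Ψ p z b)

  1+iterate-Ψ : ∀ p z b → 1# + iterate-Ψ p z b ≈ (1# + z) ^ (p ℕ.^ b)
  1+iterate-Ψ p z zero    = R.sym (*-identityʳ _)
  1+iterate-Ψ p z (suc b) = begin
    1# + y * Ψ p y               ≈⟨ Ψ-factor p y ⟨
    (1# + y) ^ p                 ≈⟨ ^-congˡ p (1+iterate-Ψ p z b) ⟩
    ((1# + z) ^ (p ℕ.^ b)) ^ p   ≈⟨ ^-assocʳ (1# + z) (p ℕ.^ b) p ⟩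
    (1# + z) ^ (p ℕ.^ b ℕ.* p)   ≡⟨ cong ((1# + z) ^_) (ℕ.*-comm (p ℕ.^ b) p) ⟩
    (1# + z) ^ (p ℕ.^ suc b)     ∎
    where
    y : Carrier
    y = iterate-Ψ p z b

  -- Frobenius, one step at a time: y Ψ(y) is y · y^p modulo `suc p`, the next power of y.
  iterate-Ψ-mod : ∀ {p} → Prime (suc p) → ∀ z b →
    ∃ λ g → iterate-Ψ (suc p) z b ≈ z ^ (suc p ℕ.^ b) + (suc p · 1#) * g
  iterate-Ψ-mod {p} pr z zero = 0# , (begin
    z                              ≈⟨ *-identityʳ z ⟨
    z * 1#                         ≈⟨ +-identityʳ (z * 1#) ⟨
    z * 1# + 0#                    ≈⟨ +-congˡ (zeroʳ (suc p · 1#)) ⟨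
    z * 1# + (suc p · 1#) * 0#     ∎)
  iterate-Ψ-mod {p} pr z (suc b) with iterate-Ψ-mod pr z b
  ... | g , eq with Ψ-leading pr (iterate-Ψ (suc p) z b) | ^-mod (suc p) (suc p) eq
  ... | h , eq₁ | k , eq₂ = k + y * h , (begin
    y * Ψ (suc p) y
      ≈⟨ *-congˡ eq₁ ⟩
    y * (y ^ p + (suc p · 1#) * h)
      ≈⟨ solve 4 (λ y u q h → y :* (u :+ q :* h) := y :* u :+ q :* (y :* h)) R.refl y (y ^ p) (suc p · 1#) h ⟩
    y * y ^ p + (suc p · 1#) * (y * h)
      ≈⟨ +-congʳ eq₂ ⟩
    ((z ^ (suc p ℕ.^ b)) ^ suc p + (suc p · 1#) * k) + (suc p · 1#) * (y * h)
      ≈⟨ solve 4 (λ u q k v → (u :+ q :* k) :+ q :* v := u :+ q :* (k :+ v)) R.refl _ (suc p · 1#) k (y * h) ⟩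
    (z ^ (suc p ℕ.^ b)) ^ suc p + (suc p · 1#) * (k + y * h)
      ≈⟨ +-congʳ (^-assocʳ z (suc p ℕ.^ b) (suc p)) ⟩
    z ^ (suc p ℕ.^ b ℕ.* suc p) + (suc p · 1#) * (k + y * h)
      ≡⟨ cong (λ e → z ^ e + (suc p · 1#) * (k + y * h)) (ℕ.*-comm (suc p ℕ.^ b) (suc p)) ⟩
    z ^ (suc p ℕ.^ suc b) + (suc p · 1#) * (k + y * h) ∎)
    where
    y : Carrier
    y = iterate-Ψ (suc p) z b

  -- The p^{b+1}-th cyclotomic polynomial at x = 1 + z.
  Φ : ℕ → Carrier → ℕ → Carrier
  Φ p z b = Ψ p (iterate-Ψ p z b)

  -- The exponent is the degree of the cyclotomic polynomial, the value of Euler's function at the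
  -- prime power `suc p ^ suc b`.
  Φ-mod : ∀ {p} → Prime (suc p) → ∀ z b →
    ∃ λ g → Φ (suc p) z b ≈ z ^ (suc p ℕ.^ b ℕ.* p) + (suc p · 1#) * g
  Φ-mod {p} pr z b with iterate-Ψ-mod pr z b
  ... | g , eq with Ψ-leading pr (iterate-Ψ (suc p) z b) | ^-mod (suc p) p eq
  ... | h , eq₁ | k , eq₂ = k + h , (begin
    Ψ (suc p) y
      ≈⟨ eq₁ ⟩
    y ^ p + (suc p · 1#) * h
      ≈⟨ +-congʳ eq₂ ⟩
    ((z ^ (suc p ℕ.^ b)) ^ p + (suc p · 1#) * k) + (suc p · 1#) * h
      ≈⟨ solve 4 (λ u q k v → (u :+ q :* k) :+ q :* v := u :+ q :* (k :+ v)) R.refl _ (suc p · 1#) k h ⟩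
    (z ^ (suc p ℕ.^ b)) ^ p + (suc p · 1#) * (k + h)
      ≈⟨ +-congʳ (^-assocʳ z (suc p ℕ.^ b) p) ⟩
    z ^ (suc p ℕ.^ b ℕ.* p) + (suc p · 1#) * (k + h) ∎)
    where
    y : Carrier
    y = iterate-Ψ (suc p) z b

-- The induction of Weisman and Wan on powers of x - 1.

module WeismanWan {c ℓ} (R : CommutativeSemiring c ℓ) where

  open CommutativeSemiring R
    renaming (Carrier to A; _+_ to _⊹_; _*_ to _∙_; refl to ≈-refl; sym to ≈-sym; trans to ≈-trans)
  open BinomialSeries R
  open import Algebra.Properties.Semiring.Mult semiring using () renaming (_×_ to _·_)
  open import Algebra.Properties.Semiring.Exp semiring using (^-homo-*) renaming (_^_ to _^ᴿ_)
  open import Algebra.Solver.Ring.NaturalCoefficients.Default R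
    using (solve; _:=_; _:+_; _:*_)

  -- Div t f l abstracts "p^t divides every value of f applied to U q l".
  module _ {p : ℕ} (pr : Prime (suc p)) (b : ℕ) (z : A)
    (Div        : ℕ → A → ℕ → Set)
    (Div-≈      : ∀ {t f g l} → f ≈ g → Div t g l → Div t f l)
    (Div-zero   : ∀ {f l} → Div 0 f l)
    (Div-∙      : ∀ {t f l} g → Div t f l → Div t (g ∙ f) l)
    (Div-⊹      : ∀ {t f g l} → Div t f l → Div t g l → Div t (f ⊹ g) l)
    (Div-cancel : ∀ {t f g h l} → f ≈ g ⊹ h → Div t f l → Div t h l → Div t g l)
    (Div-p      : ∀ {t f l} → Div t f l → Div (suc t) ((suc p · 1#) ∙ f) l)
    (Div-y-0    : ∀ {t} f → Div t (f ∙ iterate-Ψ (suc p) z (suc b)) 0)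
    (Div-y-suc  : ∀ {t l} f → Div t f l → Div t (f ∙ iterate-Ψ (suc p) z (suc b)) (suc l))
    where

    private
      p̂ y φ : A
      p̂ = suc p · 1#
      y = iterate-Ψ (suc p) z b
      φ = Φ (suc p) z b

    -- Expand z^n y φ in two stages, replacing y by z^P and then φ by z^e modulo `p̂`. The error
    -- terms carry a factor `p̂`, so divisibility by p^t of their cofactors is enough for them.
    z^-step : ∀ n P e {g g′ t l} → φ ≈ z ^ᴿ e ⊹ p̂ ∙ g → y ≈ z ^ᴿ P ⊹ p̂ ∙ g′ →
              Div t (φ ∙ z ^ᴿ n) l → Div t (z ^ᴿ (n ℕ.+ P)) l →
              Div (suc t) (z ^ᴿ n ∙ (y ∙ φ)) l → Div (suc t) (z ^ᴿ (n ℕ.+ (P ℕ.+ e))) l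
    z^-step n P e {g} {g′} φ≈ y≈ dφ dz dy =
      Div-≈ (≈-trans (^-homo-* z n (P ℕ.+ e)) (*-congˡ (^-homo-* z P e)))
        (Div-cancel eq₁
          (Div-cancel eq₂ dy (Div-p (Div-∙ g′ dφ)))
          (Div-p (Div-∙ g (Div-≈ (≈-sym (^-homo-* z n P)) dz))))
      where
      eq₁ : z ^ᴿ n ∙ (z ^ᴿ P ∙ φ) ≈ z ^ᴿ n ∙ (z ^ᴿ P ∙ z ^ᴿ e) ⊹ p̂ ∙ (g ∙ (z ^ᴿ n ∙ z ^ᴿ P))
      eq₁ = ≈-trans (*-congˡ (*-congˡ φ≈))
        (solve 5 (λ n u v p g → n :* (u :* (v :+ p :* g)) := n :* (u :* v) :+ p :* (g :* (n :* u)))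
          ≈-refl (z ^ᴿ n) (z ^ᴿ P) (z ^ᴿ e) p̂ g)
      eq₂ : z ^ᴿ n ∙ (y ∙ φ) ≈ z ^ᴿ n ∙ (z ^ᴿ P ∙ φ) ⊹ p̂ ∙ (g′ ∙ (φ ∙ z ^ᴿ n))
      eq₂ = ≈-trans (*-congˡ (*-congʳ y≈))
        (solve 5 (λ n u v p g → n :* ((u :+ p :* g) :* v) := n :* (u :* v) :+ p :* (g :* (v :* n)))
          ≈-refl (z ^ᴿ n) (z ^ᴿ P) φ p̂ g′)

    -- Compute φ · z^n · φ in two ways: with φ ≈ z^e modulo `p̂`, and with φ ≈ p̂ + y h, where the
    -- first summand gains a factor `p̂` and the second produces y φ.
    φz^-step : ∀ n e {g h t l} → φ ≈ z ^ᴿ e ⊹ p̂ ∙ g → φ ≈ p̂ ⊹ y ∙ h →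
               Div t (φ ∙ z ^ᴿ n) l → Div (suc t) (z ^ᴿ n ∙ (y ∙ φ)) l →
               Div (suc t) (φ ∙ z ^ᴿ (n ℕ.+ e)) l
    φz^-step n e {g} {h} φ≈ φ≈′ dφ dy =
      Div-≈ (*-congˡ (^-homo-* z n e))
        (Div-cancel eq₁
          (Div-≈ eq₂ (Div-⊹ (Div-∙ h dy) (Div-p dφ)))
          (Div-p (Div-∙ g dφ)))
      where
      eq₁ : φ ∙ (z ^ᴿ n ∙ φ) ≈ φ ∙ (z ^ᴿ n ∙ z ^ᴿ e) ⊹ p̂ ∙ (g ∙ (φ ∙ z ^ᴿ n))
      eq₁ = ≈-trans (*-congˡ (*-congˡ φ≈))
        (solve 5 (λ f n v p g → f :* (n :* (v :+ p :* g)) := f :* (n :* v) :+ p :* (g :* (f :* n)))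
          ≈-refl φ (z ^ᴿ n) (z ^ᴿ e) p̂ g)
      eq₂ : φ ∙ (z ^ᴿ n ∙ φ) ≈ h ∙ (z ^ᴿ n ∙ (y ∙ φ)) ⊹ p̂ ∙ (φ ∙ z ^ᴿ n)
      eq₂ = ≈-trans (*-congˡ (*-congˡ φ≈′))
        (solve 5 (λ f n p y h → f :* (n :* (p :+ y :* h)) := h :* (n :* (y :* f)) :+ p :* (f :* n))
          ≈-refl φ (z ^ᴿ n) p̂ y h)

    module _ {P e q g g′ h} (q≡ : q ≡ P ℕ.+ e)
      (φ≈ : φ ≈ z ^ᴿ e ⊹ p̂ ∙ g) (y≈ : y ≈ z ^ᴿ P ⊹ p̂ ∙ g′) (φ≈′ : φ ≈ p̂ ⊹ y ∙ h) where

      private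
        Div-z^-cong : ∀ {t l m n} → m ≡ n → Div t (z ^ᴿ m) l → Div t (z ^ᴿ n) l
        Div-z^-cong refl d = d

        Div-φz^-cong : ∀ {t l m n} → m ≡ n → Div t (φ ∙ z ^ᴿ m) l → Div t (φ ∙ z ^ᴿ n) l
        Div-φz^-cong refl d = d

        trade : ∀ l t o → e ℕ.* suc t ℕ.+ P ℕ.+ l ℕ.* q ℕ.+ o ≡ e ℕ.* t ℕ.+ suc l ℕ.* q ℕ.+ o
        trade l t o = trans (lem e P t (l ℕ.* q) o)
          (cong (λ u → e ℕ.* t ℕ.+ (u ℕ.+ l ℕ.* q) ℕ.+ o) (sym q≡))
          where
          lem : ∀ e P t m o → e ℕ.* suc t ℕ.+ P ℕ.+ m ℕ.+ o ≡ e ℕ.* t ℕ.+ ((P ℕ.+ e) ℕ.+ m) ℕ.+ o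
          lem = ℕ-Ring.solve-∀

        peel-z : ∀ t m o → e ℕ.* t ℕ.+ m ℕ.+ o ℕ.+ (P ℕ.+ e) ≡ e ℕ.* suc t ℕ.+ P ℕ.+ m ℕ.+ o
        peel-z t m o = lem e P t m o
          where
          lem : ∀ e P t m o → e ℕ.* t ℕ.+ m ℕ.+ o ℕ.+ (P ℕ.+ e) ≡ e ℕ.* suc t ℕ.+ P ℕ.+ m ℕ.+ o
          lem = ℕ-Ring.solve-∀

        peel-P : ∀ t m o → e ℕ.* t ℕ.+ P ℕ.+ m ℕ.+ o ≡ e ℕ.* t ℕ.+ m ℕ.+ o ℕ.+ P
        peel-P t m o = lem (e ℕ.* t) P m o
          where
          lem : ∀ a P m o → a ℕ.+ P ℕ.+ m ℕ.+ o ≡ a ℕ.+ m ℕ.+ o ℕ.+ P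
          lem = ℕ-Ring.solve-∀

        peel-φ : ∀ t m o → e ℕ.* t ℕ.+ m ℕ.+ o ℕ.+ e ≡ e ℕ.* suc t ℕ.+ m ℕ.+ o
        peel-φ t m o = lem e t m o
          where
          lem : ∀ e t m o → e ℕ.* t ℕ.+ m ℕ.+ o ℕ.+ e ≡ e ℕ.* suc t ℕ.+ m ℕ.+ o
          lem = ℕ-Ring.solve-∀

      mutual
        -- The three claims are proved together, by lexicographic induction on l and t. A power of z
        -- alone needs the offset P in its exponent; in the presence of φ the offset is saved, since
        -- φ² is p φ up to a multiple of y φ.
        z^-div : ∀ l t o → Div t (z ^ᴿ (e ℕ.* t ℕ.+ P ℕ.+ l ℕ.* q ℕ.+ o)) l
        z^-div l zero    o = Div-zero
        z^-div l (suc t) o = Div-z^-cong (peel-z t (l ℕ.* q) o)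
          (z^-step (e ℕ.* t ℕ.+ l ℕ.* q ℕ.+ o) P e φ≈ y≈ (φz^-div l t o)
            (Div-z^-cong (peel-P t (l ℕ.* q) o) (z^-div l t o))
            (z^yφ-div l t o))

        φz^-div : ∀ l t o → Div t (φ ∙ z ^ᴿ (e ℕ.* t ℕ.+ l ℕ.* q ℕ.+ o)) l
        φz^-div l zero    o = Div-zero
        φz^-div l (suc t) o = Div-φz^-cong (peel-φ t (l ℕ.* q) o)
          (φz^-step (e ℕ.* t ℕ.+ l ℕ.* q ℕ.+ o) e φ≈ φ≈′ (φz^-div l t o) (z^yφ-div l t o))

        z^yφ-div : ∀ l t o → Div (suc t) (z ^ᴿ (e ℕ.* t ℕ.+ l ℕ.* q ℕ.+ o) ∙ (y ∙ φ)) l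
        z^yφ-div zero    t o = Div-y-0 _
        -- y φ lowers the level by one, which releases q = P + e from the exponent: e buys the
        -- factor p^{t+1}, and P is the offset of `z^-div`.
        z^yφ-div (suc l) t o = Div-y-suc _ (Div-z^-cong (trade l t o) (z^-div l (suc t) o))

module BracketDivisibility where

  open import Algebra.Properties.AbelianGroup ℤ.+-0-abelianGroup using () renaming (∙-cancelˡ to ℤ+-cancelˡ)
  open import Data.Integer.Base as ℤ using (ℤ; +_; -[1+_]; _+_; _-_; _*_; -_; -1ℤ; _/ℕ_; _%ℕ_)
  open import Data.Integer.DivMod using (n%ℕd<d; a≡a%ℕn+[a/ℕn]*n; [n/ℕd]*d≤n)
  open import Data.Integer.Divisibility.Signed
    using (_∣_; divides; quotient; _∣?_; ∣-refl; ∣-trans; ∣m∣n⇒∣m+n; ∣m∣n⇒∣m-n; ∣m⇒∣-m;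
           ∣m+n∣m⇒∣n; ∣m+n∣n⇒∣m; ∣n⇒∣m*n; ∣m⇒∣m*n; *-monoʳ-∣; *-monoˡ-∣; *-cancelˡ-∣; *-cancelʳ-∣; 0∣⇒≡0)

  -- Finite sums and products of integers.

  ∑ : ℕ → (ℕ → ℤ) → ℤ
  ∑ zero    f = + 0
  ∑ (suc n) f = f 0 + ∑ n (f ∘ suc)

  ∑-cong : ∀ n {f g} → (∀ k → k ℕ.< n → f k ≡ g k) → ∑ n f ≡ ∑ n g
  ∑-cong zero    f≡g = refl
  ∑-cong (suc n) f≡g = cong₂ _+_ (f≡g 0 (s≤s z≤n)) (∑-cong n (λ k k<n → f≡g (suc k) (s≤s k<n)))

  ∑-zero : ∀ n {f} → (∀ k → k ℕ.< n → f k ≡ + 0) → ∑ n f ≡ + 0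
  ∑-zero zero    f≡0 = refl
  ∑-zero (suc n) f≡0 =
    cong₂ _+_ (f≡0 0 (s≤s z≤n)) (∑-zero n (λ k k<n → f≡0 (suc k) (s≤s k<n)))

  ∑-+ : ∀ n f g → ∑ n (λ k → f k + g k) ≡ ∑ n f + ∑ n g
  ∑-+ zero    f g = refl
  ∑-+ (suc n) f g =
    trans (cong (_+_ (f 0 + g 0)) (∑-+ n (f ∘ suc) (g ∘ suc))) (lem (f 0) (g 0) _ _)
    where
    lem : ∀ a b c d → (a + b) + (c + d) ≡ (a + c) + (b + d)
    lem = ℤ-Ring.solve-∀

  ∑-*ˡ : ∀ n c f → ∑ n (λ k → c * f k) ≡ c * ∑ n f
  ∑-*ˡ zero    c f = sym (ℤ.*-zeroʳ c)
  ∑-*ˡ (suc n) c f =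
    trans (cong (_+_ (c * f 0)) (∑-*ˡ n c (f ∘ suc))) (sym (ℤ.*-distribˡ-+ c (f 0) _))

  ∑-- : ∀ n f g → ∑ n (λ k → f k - g k) ≡ ∑ n f - ∑ n g
  ∑-- n f g = begin
    ∑ n (λ k → f k + - g k)      ≡⟨ ∑-+ n f (λ k → - g k) ⟩
    ∑ n f + ∑ n (λ k → - g k)    ≡⟨ cong (_+_ (∑ n f)) (∑-cong n (λ k _ → sym (ℤ.-1*i≡-i (g k)))) ⟩
    ∑ n f + ∑ n (λ k → -1ℤ * g k) ≡⟨ cong (_+_ (∑ n f)) (trans (∑-*ˡ n -1ℤ g) (ℤ.-1*i≡-i (∑ n g))) ⟩
    ∑ n f - ∑ n g                ∎
    where open ≡-Reasoning

  ∑-swap : ∀ m n (f : ℕ → ℕ → ℤ) → ∑ m (λ i → ∑ n (f i)) ≡ ∑ n (λ j → ∑ m (λ i → f i j))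
  ∑-swap zero    n f = sym (∑-zero n (λ _ _ → refl))
  ∑-swap (suc m) n f = begin
    ∑ n (f 0) + ∑ m (λ i → ∑ n (f (suc i)))         ≡⟨ cong (_+_ (∑ n (f 0))) (∑-swap m n (f ∘ suc)) ⟩
    ∑ n (f 0) + ∑ n (λ j → ∑ m (λ i → f (suc i) j)) ≡⟨ ∑-+ n (f 0) _ ⟨
    ∑ n (λ j → f 0 j + ∑ m (λ i → f (suc i) j))     ∎
    where open ≡-Reasoning

  ∑-split : ∀ m n f → ∑ (m ℕ.+ n) f ≡ ∑ m f + ∑ n (λ k → f (m ℕ.+ k))
  ∑-split zero    n f = sym (ℤ.+-identityˡ _)
  ∑-split (suc m) n f =
    trans (cong (_+_ (f 0)) (∑-split m n (f ∘ suc))) (sym (ℤ.+-assoc (f 0) _ _))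

  ∑-∣ : ∀ {d} n {f} → (∀ k → k ℕ.< n → d ∣ f k) → d ∣ ∑ n f
  ∑-∣ zero    d∣f = divides (+ 0) refl
  ∑-∣ (suc n) d∣f = ∣m∣n⇒∣m+n (d∣f 0 (s≤s z≤n)) (∑-∣ n (λ k k<n → d∣f (suc k) (s≤s k<n)))

  ∑-multiples : ∀ p .{{_ : NonZero p}} n f → (∀ k → ¬ (p ℕ∣.∣ k) → f k ≡ + 0) →
                ∑ (suc (p ℕ.* n)) f ≡ ∑ (suc n) (λ j → f (p ℕ.* j))
  ∑-multiples p zero f f≡0 rewrite ℕ.*-zeroʳ p = refl
  ∑-multiples p@(suc p-1) (suc n) f f≡0 = begin
    ∑ (suc (p ℕ.* suc n)) f
      ≡⟨ cong (λ m → ∑ m f) (trans (cong suc (ℕ.*-suc p n)) (sym (ℕ.+-suc p (p ℕ.* n)))) ⟩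
    ∑ (p ℕ.+ suc (p ℕ.* n)) f
      ≡⟨ ∑-split p (suc (p ℕ.* n)) f ⟩
    (f 0 + ∑ p-1 (f ∘ suc)) + ∑ (suc (p ℕ.* n)) (λ k → f (p ℕ.+ k))
      ≡⟨ cong₂ (λ u v → (f 0 + u) + v)
           (∑-zero p-1 (λ k k<p → f≡0 (suc k) (λ p∣ → ℕ.<⇒≱ (s≤s k<p) (ℕ∣.∣⇒≤ p∣))))
           (∑-multiples p n (λ k → f (p ℕ.+ k)) (λ k p∤k → f≡0 (p ℕ.+ k) (λ p∣ → p∤k (ℕ∣.∣m+n∣m⇒∣n p∣ ℕ∣.∣-refl)))) ⟩
    (f 0 + + 0) + ∑ (suc n) (λ j → f (p ℕ.+ p ℕ.* j))
      ≡⟨ cong₂ _+_ (trans (ℤ.+-identityʳ (f 0)) (cong f (sym (ℕ.*-zeroʳ p))))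
           (∑-cong (suc n) (λ j _ → cong f (sym (ℕ.*-suc p j)))) ⟩
    f (p ℕ.* 0) + ∑ (suc n) (λ j → f (p ℕ.* suc j)) ∎
    where open ≡-Reasoning

  ∏ : ℕ → (ℕ → ℤ) → ℤ
  ∏ zero    f = + 1
  ∏ (suc n) f = f 0 * ∏ n (f ∘ suc)

  ∏-cong : ∀ n {f g} → (∀ k → k ℕ.< n → f k ≡ g k) → ∏ n f ≡ ∏ n g
  ∏-cong zero    f≡g = refl
  ∏-cong (suc n) f≡g = cong₂ _*_ (f≡g 0 (s≤s z≤n)) (∏-cong n (λ k k<n → f≡g (suc k) (s≤s k<n)))

  ∏-* : ∀ n f g → ∏ n (λ k → f k * g k) ≡ ∏ n f * ∏ n g
  ∏-* zero    f g = refl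
  ∏-* (suc n) f g =
    trans (cong (f 0 * g 0 *_) (∏-* n (f ∘ suc) (g ∘ suc)))
      (lem (f 0) (g 0) (∏ n (f ∘ suc)) (∏ n (g ∘ suc)))
    where
    lem : ∀ a b c d → (a * b) * (c * d) ≡ (a * c) * (b * d)
    lem = ℤ-Ring.solve-∀

  ∏-const : ∀ n c → ∏ n (λ _ → c) ≡ c ℤ.^ n
  ∏-const zero    c = refl
  ∏-const (suc n) c = cong (c *_) (∏-const n c)

  ∏-split : ∀ m n f → ∏ (m ℕ.+ n) f ≡ ∏ m f * ∏ n (λ k → f (m ℕ.+ k))
  ∏-split zero    n f = sym (ℤ.*-identityˡ (∏ n f))
  ∏-split (suc m) n f =
    trans (cong (f 0 *_) (∏-split m n (f ∘ suc)))
      (sym (ℤ.*-assoc (f 0) (∏ m (f ∘ suc)) (∏ n (λ k → f (suc m ℕ.+ k)))))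

  ∏-last : ∀ n f → ∏ (suc n) f ≡ ∏ n f * f n
  ∏-last zero    f = ℤ.*-comm (f 0) (+ 1)
  ∏-last (suc n) f =
    trans (cong (f 0 *_) (∏-last n (f ∘ suc))) (sym (ℤ.*-assoc (f 0) (∏ n (f ∘ suc)) (f (suc n))))

  ∏-reverse : ∀ n f → ∏ n f ≡ ∏ n (λ k → f (n ℕ.∸ suc k))
  ∏-reverse zero    f = refl
  ∏-reverse (suc n) f = begin
    ∏ (suc n) f                                ≡⟨ ∏-last n f ⟩
    ∏ n f * f n                                ≡⟨ ℤ.*-comm (∏ n f) (f n) ⟩
    f n * ∏ n f                                ≡⟨ cong (f n *_) (∏-reverse n f) ⟩
    f n * ∏ n (λ k → f (n ℕ.∸ suc k))          ∎
    where open ≡-Reasoning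

  ∣-*-cong : ∀ {d a b c e} → d ∣ a - b → d ∣ c - e → d ∣ a * c - b * e
  ∣-*-cong {d} {a} {b} {c} {e} d∣ d∣′ =
    subst (d ∣_) (lem a b c e) (∣m∣n⇒∣m+n (∣m⇒∣m*n c d∣) (∣n⇒∣m*n b d∣′))
    where
    lem : ∀ a b c e → (a - b) * c + b * (c - e) ≡ a * c - b * e
    lem = ℤ-Ring.solve-∀

  ∏-∣-cong : ∀ {d} n {f g} → (∀ k → d ∣ f k - g k) → d ∣ ∏ n f - ∏ n g
  ∏-∣-cong zero    d∣ = divides (+ 0) refl
  ∏-∣-cong (suc n) {f} {g} d∣ =
    ∣-*-cong {a = f 0} {b = g 0} {c = ∏ n (f ∘ suc)} {e = ∏ n (g ∘ suc)} (d∣ 0) (∏-∣-cong n (d∣ ∘ suc))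

  euclid : ∀ {p} → Prime p → ∀ a b → + p ∣ a * b → + p ∣ a ⊎ + p ∣ b
  euclid {p} pr a b d = Sum.map ∣ᵤ⇒∣ ∣ᵤ⇒∣
    (euclidsLemma ℤ.∣ a ∣ ℤ.∣ b ∣ pr (subst (p ℕ∣.∣_) (ℤ.abs-* a b) (∣⇒∣ᵤ d)))

  ∏-∤ : ∀ {p} → Prime p → (¬ (+ p ∣ + 1)) → ∀ n {f} → (∀ k → k ℕ.< n → ¬ (+ p ∣ f k)) → ¬ (+ p ∣ ∏ n f)
  ∏-∤ pr p∤1 zero    p∤f d = p∤1 d
  ∏-∤ pr p∤1 (suc n) {f} p∤f d with euclid pr (f 0) (∏ n (f ∘ suc)) d
  ... | inj₁ e = p∤f 0 (s≤s z≤n) e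
  ... | inj₂ e = ∏-∤ pr p∤1 n (λ k k<n → p∤f (suc k) (s≤s k<n)) e

  -- Euclid's lemma moves one factor p at a time into a. Cancelling units in this way replaces
  -- inverses modulo prime powers.
  ^-∣-cancel : ∀ {p} → Prime p → ∀ t {a} b → ¬ (+ p ∣ b) → + (p ℕ.^ t) ∣ a * b → + (p ℕ.^ t) ∣ a
  ^-∣-cancel {p} pr zero    {a} b p∤b d = divides a (sym (ℤ.*-identityʳ a))
  ^-∣-cancel {p} pr (suc t) {a} b p∤b d
    with euclid pr a b (∣-trans (divides (+ (p ℕ.^ t)) (trans (ℤ.pos-* p (p ℕ.^ t)) (ℤ.*-comm (+ p) (+ (p ℕ.^ t))))) d)
  ... | inj₂ p∣b = ⊥-elim (p∤b p∣b)
  ... | inj₁ (divides c refl) =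
    subst (_∣ c * + p) (trans (ℤ.*-comm (+ (p ℕ.^ t)) (+ p)) (sym (ℤ.pos-* p (p ℕ.^ t))))
      (*-monoˡ-∣ (+ p) {x = + (p ℕ.^ t)} {y = c} (^-∣-cancel pr t {c} b p∤b
        (*-cancelˡ-∣ (+ p) {{prime⇒nonZero pr}}
          (subst (_∣ + p * (c * b)) (ℤ.pos-* p (p ℕ.^ t)) (subst (+ (p ℕ.^ suc t) ∣_) (lem c b (+ p)) d)))))
    where
    lem : ∀ c b p → c * p * b ≡ p * (c * b)
    lem = ℤ-Ring.solve-∀

  -- Fermat's little theorem and power sums modulo p.

  module Fermat where
    module R = CommutativeSemiring ℤ.+-*-commutativeSemiring
    open BinomialSeries ℤ.+-*-commutativeSemiring
    open import Algebra.Properties.Semiring.Mult R.semiring using () renaming (_×_ to _·_)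
    open import Algebra.Properties.Semiring.Exp R.semiring using () renaming (_^_ to _^ᴿ_)

    ^≡ : ∀ x n → x ^ᴿ n ≡ x ℤ.^ n
    ^≡ x zero    = refl
    ^≡ x (suc n) = cong (x *_) (^≡ x n)

    ·1≡ : ∀ n → n · + 1 ≡ + n
    ·1≡ zero    = refl
    ·1≡ (suc n) = cong (_+_ (+ 1)) (·1≡ n)

    -- The factorisation (1+z)^p = 1 + z Ψ(z), for p the prime, is now read in ℤ; Ψ(z) is z^{p-1}
    -- modulo p.
    frobenius : ∀ {p} → Prime (suc p) → ∀ z → + suc p ∣ (+ 1 + z) ℤ.^ suc p - (+ 1 + z ℤ.^ suc p)
    frobenius {p} pr z with Ψ-leading pr z
    ... | g , Ψ≡ = divides (z * g) (begin
      (+ 1 + z) ℤ.^ suc p - (+ 1 + z ℤ.^ suc p)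
        ≡⟨ cong (_- (+ 1 + z ℤ.^ suc p)) (trans (sym (^≡ (+ 1 + z) (suc p))) (Ψ-factor (suc p) z)) ⟩
      (+ 1 + z * Ψ (suc p) z) - (+ 1 + z ℤ.^ suc p)
        ≡⟨ cong (λ u → (+ 1 + z * u) - (+ 1 + z ℤ.^ suc p)) (trans Ψ≡
             (cong₂ (λ u v → u + v * g) (^≡ z p) (·1≡ (suc p)))) ⟩
      (+ 1 + z * (z ℤ.^ p + + suc p * g)) - (+ 1 + z * z ℤ.^ p)
        ≡⟨ lem z (z ℤ.^ p) (+ suc p) g ⟩
      z * g * + suc p ∎)
      where
      open ≡-Reasoning
      lem : ∀ z y p g → (+ 1 + z * (y + p * g)) - (+ 1 + z * y) ≡ z * g * p
      lem = ℤ-Ring.solve-∀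

    x^p-x : ∀ {p} → Prime (suc p) → ∀ x → + suc p ∣ (+ x) ℤ.^ suc p - + x
    x^p-x {p} pr zero    = divides (+ 0) refl
    x^p-x {p} pr (suc x) = subst (+ suc p ∣_) (lem ((+ 1 + + x) ℤ.^ suc p) ((+ x) ℤ.^ suc p) (+ x))
      (∣m∣n⇒∣m+n (frobenius pr (+ x)) (x^p-x pr x))
      where
      lem : ∀ a b x → (a - (+ 1 + b)) + (b - x) ≡ a - (+ 1 + x)
      lem = ℤ-Ring.solve-∀

  fermat : ∀ {p} → Prime (suc p) → ∀ x → ¬ (+ suc p ∣ + x) → + suc p ∣ (+ x) ℤ.^ p - + 1
  fermat {p} pr x p∤x with euclid pr (+ x) ((+ x) ℤ.^ p - + 1)
      (subst (+ suc p ∣_) (lem (+ x) ((+ x) ℤ.^ p)) (Fermat.x^p-x pr x))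
    where
    lem : ∀ x y → x * y - x ≡ x * (y - + 1)
    lem = ℤ-Ring.solve-∀
  ... | inj₁ d = ⊥-elim (p∤x d)
  ... | inj₂ d = d

  -- Induction on k through s C(s,i) = (i+1) C(s,i+1) + i C(s,i).
  ∑-power : ∀ {p} → Prime p → ∀ k i → suc (i ℕ.+ k) ℕ.< p →
            + p ∣ ∑ p (λ s → (+ s) ℤ.^ k * + (s C i))
  ∑-power {p} pr zero    i i<p = subst (+ p ∣_)
    (sym (trans (∑-cong p (λ s _ → ℤ.*-identityˡ (+ (s C i)))) (hockey p)))
    (∣ᵤ⇒∣ (p∣pCk pr i (subst (λ j → suc j ℕ.< p) (ℕ.+-identityʳ i) i<p)))
    where
    hockey : ∀ n → ∑ n (λ s → + (s C i)) ≡ + (n C suc i)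
    hockey zero    = cong +_ (sym (k>n⇒nCk≡0 {0} {suc i} (s≤s z≤n)))
    hockey (suc n) = begin
      ∑ (suc n) (λ s → + (s C i))                      ≡⟨ cong (λ m → ∑ m (λ s → + (s C i))) (ℕ.+-comm n 1) ⟨
      ∑ (n ℕ.+ 1) (λ s → + (s C i))                    ≡⟨ ∑-split n 1 (λ s → + (s C i)) ⟩
      ∑ n (λ s → + (s C i)) + (+ ((n ℕ.+ 0) C i) + + 0) ≡⟨ cong₂ _+_ (hockey n) (trans (ℤ.+-identityʳ (+ ((n ℕ.+ 0) C i))) (cong (λ m → + (m C i)) (ℕ.+-identityʳ n))) ⟩
      + (n C suc i ℕ.+ n C i)                          ≡⟨ cong +_ (ℕ.+-comm (n C suc i) (n C i)) ⟩
      + (n C i ℕ.+ n C suc i)                          ≡⟨ cong +_ (nCk+nC[k+1]≡[n+1]C[k+1] n i) ⟩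
      + (suc n C suc i)                                ∎
      where open ≡-Reasoning
  ∑-power {p} pr (suc k) i i<p = subst (+ p ∣_) (sym expand)
    (∣m∣n⇒∣m+n (∣n⇒∣m*n (+ suc i) (∑-power pr k (suc i) (subst (λ m → suc m ℕ.< p) (ℕ.+-suc i k) i<p)))
               (∣n⇒∣m*n (+ i) (∑-power pr k i (ℕ.<-trans (s≤s (ℕ.+-monoʳ-< i (ℕ.n<1+n k))) i<p))))
    where
    open ≡-Reasoning
    f g : ℕ → ℤ
    f s = (+ s) ℤ.^ k * + (s C suc i)
    g s = (+ s) ℤ.^ k * + (s C i)
    s*sCi : ∀ s → s ℕ.* (s C i) ≡ suc i ℕ.* (s C suc i) ℕ.+ i ℕ.* (s C i)
    s*sCi s = ℕ.+-cancelˡ-≡ (s C i) _ _ (begin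
      suc s ℕ.* (s C i)                                          ≡⟨ C-absorb s i ⟨
      suc i ℕ.* (suc s C suc i)                                  ≡⟨ cong (suc i ℕ.*_) (nCk+nC[k+1]≡[n+1]C[k+1] s i) ⟨
      suc i ℕ.* (s C i ℕ.+ s C suc i)                            ≡⟨ lem i (s C i) (s C suc i) ⟩
      s C i ℕ.+ (suc i ℕ.* (s C suc i) ℕ.+ i ℕ.* (s C i))        ∎)
      where
      lem : ∀ i a b → suc i ℕ.* (a ℕ.+ b) ≡ a ℕ.+ (suc i ℕ.* b ℕ.+ i ℕ.* a)
      lem = ℕ-Ring.solve-∀
    pointwise : ∀ s → (+ s) ℤ.^ suc k * + (s C i) ≡ + suc i * f s + + i * g s
    pointwise s = begin
      + s * (+ s) ℤ.^ k * + (s C i)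
        ≡⟨ lem₁ (+ s) ((+ s) ℤ.^ k) (+ (s C i)) ⟩
      (+ s) ℤ.^ k * (+ s * + (s C i))
        ≡⟨ cong ((+ s) ℤ.^ k *_) (trans (sym (ℤ.pos-* s (s C i))) (trans (cong +_ (s*sCi s))
             (cong₂ _+_ (ℤ.pos-* (suc i) (s C suc i)) (ℤ.pos-* i (s C i))))) ⟩
      (+ s) ℤ.^ k * (+ suc i * + (s C suc i) + + i * + (s C i))
        ≡⟨ lem₂ ((+ s) ℤ.^ k) (+ suc i) (+ (s C suc i)) (+ i) (+ (s C i)) ⟩
      + suc i * f s + + i * g s ∎
      where
      lem₁ : ∀ s y c → s * y * c ≡ y * (s * c)
      lem₁ = ℤ-Ring.solve-∀
      lem₂ : ∀ y a b c d → y * (a * b + c * d) ≡ a * (y * b) + c * (y * d)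
      lem₂ = ℤ-Ring.solve-∀
    expand : ∑ p (λ s → (+ s) ℤ.^ suc k * + (s C i)) ≡ + suc i * ∑ p f + + i * ∑ p g
    expand = trans (∑-cong p (λ s _ → pointwise s))
      (trans (∑-+ p (λ s → + suc i * f s) (λ s → + i * g s)) (cong₂ _+_ (∑-*ˡ p (+ suc i) f) (∑-*ˡ p (+ i) g)))

  -- A Wolstenholme-type congruence

  C-factorial : ∀ j m → ((j ℕ.+ m) C j) ℕ.* (j ! ℕ.* m !) ≡ (j ℕ.+ m) !
  C-factorial j m = begin
    ((j ℕ.+ m) C j) ℕ.* (j ! ℕ.* m !)
      ≡⟨ cong (λ k → ((j ℕ.+ m) C j) ℕ.* (j ! ℕ.* k !)) (ℕ.m+n∸m≡n j m) ⟨
    ((j ℕ.+ m) C j) ℕ.* (j ! ℕ.* (j ℕ.+ m ℕ.∸ j) !)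
      ≡⟨ cong (ℕ._* (j ! ℕ.* (j ℕ.+ m ℕ.∸ j) !)) (nCk≡n!/k![n-k]! (ℕ.m≤m+n j m)) ⟩
    _ ≡⟨ m/n*n≡m {{j ℕ.!* (j ℕ.+ m ℕ.∸ j) !≢0}} (k![n∸k]!∣n! (ℕ.m≤m+n j m)) ⟩
    (j ℕ.+ m) ! ∎
    where open ≡-Reasoning

  rising-factorial : ∀ m k → + ((m ℕ.+ k) !) ≡ + (m !) * ∏ k (λ s → + (m ℕ.+ suc s))
  rising-factorial m zero    =
    trans (cong (λ n → + (n !)) (ℕ.+-identityʳ m)) (sym (ℤ.*-identityʳ (+ (m !))))
  rising-factorial m (suc k) = begin
    + ((m ℕ.+ suc k) !)
      ≡⟨ cong (λ n → + (n !)) (ℕ.+-suc m k) ⟩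
    + ((suc m ℕ.+ k) !)
      ≡⟨ rising-factorial (suc m) k ⟩
    + (suc m !) * ∏ k (λ s → + (suc m ℕ.+ suc s))
      ≡⟨ cong₂ _*_ (ℤ.pos-* (suc m) (m !)) (∏-cong k (λ s _ → cong +_ (sym (ℕ.+-suc m (suc s))))) ⟩
    + suc m * + (m !) * ∏ k (λ s → + (m ℕ.+ suc (suc s)))
      ≡⟨ lem (+ suc m) (+ (m !)) _ ⟩
    + (m !) * (+ suc m * ∏ k (λ s → + (m ℕ.+ suc (suc s))))
      ≡⟨ cong (λ n → + (m !) * (+ n * ∏ k (λ s → + (m ℕ.+ suc (suc s))))) (ℕ.+-comm m 1) ⟨
    + (m !) * (+ (m ℕ.+ 1) * ∏ k (λ s → + (m ℕ.+ suc (suc s)))) ∎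
    where
    open ≡-Reasoning
    lem : ∀ a b c → a * b * c ≡ b * (a * c)
    lem = ℤ-Ring.solve-∀

  module Blocks (p : ℕ) where

    q : ℕ
    q = suc p

    u : ℕ → ℕ → ℤ
    u i s = + (q ℕ.* i ℕ.+ suc s)

    -- The product of x + u over the u in [1, q j] that are not multiples of q.
    F : ℕ → ℤ → ℤ
    F j x = ∏ j (λ i → ∏ p (λ s → x + u i s))

    -- The multiples q, 2q, ..., nq contribute q^n n!, and the remaining factors form F.
    factorial-F : ∀ n → + ((q ℕ.* n) !) ≡ + (q ℕ.^ n) * + (n !) * F n (+ 0)
    factorial-F zero    = cong (λ m → + (m !)) (ℕ.*-zeroʳ p)
    factorial-F (suc n) = begin
      + ((q ℕ.* suc n) !)
        ≡⟨ cong (λ m → + (m !)) lem₁ ⟩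
      + (suc (q ℕ.* n ℕ.+ p) !)
        ≡⟨ ℤ.pos-* (suc (q ℕ.* n ℕ.+ p)) ((q ℕ.* n ℕ.+ p) !) ⟩
      + suc (q ℕ.* n ℕ.+ p) * + ((q ℕ.* n ℕ.+ p) !)
        ≡⟨ cong₂ _*_ (trans (cong +_ (sym lem₁)) (ℤ.pos-* q (suc n))) (rising-factorial (q ℕ.* n) p) ⟩
      + q * + suc n * (+ ((q ℕ.* n) !) * B)
        ≡⟨ cong (λ v → + q * + suc n * (v * B)) (factorial-F n) ⟩
      + q * + suc n * (+ (q ℕ.^ n) * + (n !) * F n (+ 0) * B)
        ≡⟨ lem₂ (+ q) (+ suc n) (+ (q ℕ.^ n)) (+ (n !)) (F n (+ 0)) B ⟩
      (+ q * + (q ℕ.^ n)) * (+ suc n * + (n !)) * (F n (+ 0) * B)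
        ≡⟨ cong₂ _*_ (cong₂ _*_ (ℤ.pos-* q (q ℕ.^ n)) (ℤ.pos-* (suc n) (n !))) last ⟨
      + (q ℕ.^ suc n) * + (suc n !) * F (suc n) (+ 0) ∎
      where
      open ≡-Reasoning
      B : ℤ
      B = ∏ p (λ s → + (q ℕ.* n ℕ.+ suc s))
      lem₁ : q ℕ.* suc n ≡ suc (q ℕ.* n ℕ.+ p)
      lem₁ = go p n
        where
        go : ∀ p n → suc p ℕ.* suc n ≡ suc (suc p ℕ.* n ℕ.+ p)
        go = ℕ-Ring.solve-∀
      lem₂ : ∀ a b c d e f → a * b * (c * d * e * f) ≡ (a * c) * (b * d) * (e * f)
      lem₂ = ℤ-Ring.solve-∀
      last : F (suc n) (+ 0) ≡ F n (+ 0) * B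
      last = trans (∏-last n (λ i → ∏ p (λ s → + 0 + u i s)))
        (cong (F n (+ 0) *_) (∏-cong p (λ s _ → ℤ.+-identityˡ (u n s))))

    F-split : ∀ m j → F (m ℕ.+ j) (+ 0) ≡ F m (+ 0) * F j (+ (q ℕ.* m))
    F-split m j = trans (∏-split m j (λ i → ∏ p (λ s → + 0 + u i s)))
      (cong (F m (+ 0) *_) (∏-cong j (λ i _ → ∏-cong p (λ s _ → cong +_ (lem q m i s)))))
      where
      lem : ∀ q m i s → q ℕ.* (m ℕ.+ i) ℕ.+ suc s ≡ q ℕ.* m ℕ.+ (q ℕ.* i ℕ.+ suc s)
      lem = ℕ-Ring.solve-∀

    -- After `factorial-F` the powers of q cancel and the small factorials recombine into C(j+m, j).
    -- What remains is the ratio F j (q m) : F j 0 of products over non-multiples of q.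
    C-F : ∀ j m → + ((q ℕ.* (j ℕ.+ m)) C (q ℕ.* j)) * F j (+ 0) ≡ + ((j ℕ.+ m) C j) * F j (+ (q ℕ.* m))
    C-F j m = ℤ.*-cancelʳ-≡ _ _ (+ (q ℕ.^ j) * + (j !) * + ((q ℕ.* m) !)) {{nz}} (begin
      c′ * F j (+ 0) * (+ (q ℕ.^ j) * + (j !) * + ((q ℕ.* m) !))
        ≡⟨ lem₁ c′ (F j (+ 0)) (+ (q ℕ.^ j)) (+ (j !)) (+ ((q ℕ.* m) !)) ⟩
      c′ * (+ (q ℕ.^ j) * + (j !) * F j (+ 0) * + ((q ℕ.* m) !))
        ≡⟨ cong (λ v → c′ * (v * + ((q ℕ.* m) !))) (factorial-F j) ⟨
      c′ * (+ ((q ℕ.* j) !) * + ((q ℕ.* m) !))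
        ≡⟨ C-factorial′ (q ℕ.* j) (q ℕ.* m) (q ℕ.* (j ℕ.+ m)) (sym (ℕ.*-distribˡ-+ q j m)) ⟩
      + ((q ℕ.* (j ℕ.+ m)) !)
        ≡⟨ factorial-F (j ℕ.+ m) ⟩
      + (q ℕ.^ (j ℕ.+ m)) * + ((j ℕ.+ m) !) * F (j ℕ.+ m) (+ 0)
        ≡⟨ cong₂ _*_ (cong₂ _*_ (trans (cong +_ (ℕ.^-distribˡ-+-* q j m)) (ℤ.pos-* (q ℕ.^ j) (q ℕ.^ m)))
                                 (sym (C-factorial′ j m (j ℕ.+ m) refl)))
                     (trans (cong (λ k → F k (+ 0)) (ℕ.+-comm j m)) (F-split m j)) ⟩
      (+ (q ℕ.^ j) * + (q ℕ.^ m)) * (c * (+ (j !) * + (m !))) * (F m (+ 0) * F j (+ (q ℕ.* m)))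
        ≡⟨ lem₂ (+ (q ℕ.^ j)) (+ (q ℕ.^ m)) c (+ (j !)) (+ (m !)) (F m (+ 0)) (F j (+ (q ℕ.* m))) ⟩
      c * F j (+ (q ℕ.* m)) * (+ (q ℕ.^ j) * + (j !) * (+ (q ℕ.^ m) * + (m !) * F m (+ 0)))
        ≡⟨ cong (λ v → c * F j (+ (q ℕ.* m)) * (+ (q ℕ.^ j) * + (j !) * v)) (factorial-F m) ⟨
      c * F j (+ (q ℕ.* m)) * (+ (q ℕ.^ j) * + (j !) * + ((q ℕ.* m) !)) ∎)
      where
      open ≡-Reasoning
      c c′ : ℤ
      c  = + ((j ℕ.+ m) C j)
      c′ = + ((q ℕ.* (j ℕ.+ m)) C (q ℕ.* j))
      C-factorial′ : ∀ a b n → a ℕ.+ b ≡ n → + (n C a) * (+ (a !) * + (b !)) ≡ + (n !)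
      C-factorial′ a b _ refl = trans (cong (+ ((a ℕ.+ b) C a) *_) (sym (ℤ.pos-* (a !) (b !))))
        (trans (sym (ℤ.pos-* ((a ℕ.+ b) C a) (a ! ℕ.* b !))) (cong +_ (C-factorial a b)))
      nz : ℤ.NonZero (+ (q ℕ.^ j) * + (j !) * + ((q ℕ.* m) !))
      nz = ℤ.i*j≢0 (+ (q ℕ.^ j) * + (j !)) (+ ((q ℕ.* m) !))
             {{ℤ.i*j≢0 (+ (q ℕ.^ j)) (+ (j !)) {{ℕ.m^n≢0 q j}} {{j ℕ.!≢0}}}} {{(q ℕ.* m) ℕ.!≢0}}
      lem₁ : ∀ a b c d e → a * b * (c * d * e) ≡ a * (c * d * b * e)
      lem₁ = ℤ-Ring.solve-∀
      lem₂ : ∀ a b c d e f g → (a * b) * (c * (d * e)) * (f * g) ≡ c * g * (a * d * (b * e * f))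
      lem₂ = ℤ-Ring.solve-∀

    -- The reflection u ↦ q j - u permutes the non-multiples of q in [1, q j].
    F-reverse : ∀ j x → F j x ≡ ∏ j (λ i → ∏ p (λ s → x + + (q ℕ.* j) - u i s))
    F-reverse j x = trans (∏-reverse j (λ i → ∏ p (λ s → x + u i s)))
      (∏-cong j (λ i i<j → trans (∏-reverse p (λ s → x + u (j ℕ.∸ suc i) s))
        (∏-cong p (λ s s<p → opposite i i<j s s<p))))
      where
      opposite : ∀ i → i ℕ.< j → ∀ s → s ℕ.< p →
                 x + u (j ℕ.∸ suc i) (p ℕ.∸ suc s) ≡ x + + (q ℕ.* j) - u i s
      opposite i i<j s s<p with ℕ.m≤n⇒∃[o]m+o≡n i<j | ℕ.m≤n⇒∃[o]m+o≡n s<p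
      ... | o , refl | t , refl rewrite ℕ.m+n∸m≡n i o | ℕ.m+n∸m≡n s t = begin
        x + + (suc (suc s ℕ.+ t) ℕ.* o ℕ.+ suc t)
          ≡⟨ lem₁ x (+ (suc (suc s ℕ.+ t) ℕ.* o ℕ.+ suc t)) (+ (suc (suc s ℕ.+ t) ℕ.* i ℕ.+ suc s)) ⟩
        x + + (suc (suc s ℕ.+ t) ℕ.* o ℕ.+ suc t ℕ.+ (suc (suc s ℕ.+ t) ℕ.* i ℕ.+ suc s)) - + (suc (suc s ℕ.+ t) ℕ.* i ℕ.+ suc s)
          ≡⟨ cong (λ v → x + + v - + (suc (suc s ℕ.+ t) ℕ.* i ℕ.+ suc s)) (lem₂ s t i o) ⟩
        x + + (suc (suc s ℕ.+ t) ℕ.* (suc i ℕ.+ o)) - + (suc (suc s ℕ.+ t) ℕ.* i ℕ.+ suc s) ∎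
        where
        open ≡-Reasoning
        lem₁ : ∀ x a b → x + a ≡ x + (a + b) - b
        lem₁ = ℤ-Ring.solve-∀
        lem₂ : ∀ s t i o → suc (suc s ℕ.+ t) ℕ.* o ℕ.+ suc t ℕ.+ (suc (suc s ℕ.+ t) ℕ.* i ℕ.+ suc s)
                         ≡ suc (suc s ℕ.+ t) ℕ.* (suc i ℕ.+ o)
        lem₂ = ℕ-Ring.solve-∀

    -- The sign (-1)^{(q-1) j}, which is 1 for odd q and (-1)^j for q = 2. Carrying it along keeps
    -- the reflection argument uniform in q.
    ε : ℕ → ℤ
    ε j = (-1ℤ ℤ.^ p) ℤ.^ j

    F-reflect : ∀ j x → F j x ≡ ε j * F j (- (x + + (q ℕ.* j)))
    F-reflect j x = begin
      F j x
        ≡⟨ F-reverse j x ⟩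
      ∏ j (λ i → ∏ p (λ s → x + + (q ℕ.* j) - u i s))
        ≡⟨ ∏-cong j (λ i _ → trans (∏-cong p (λ s _ → lem (x + + (q ℕ.* j)) (u i s)))
             (∏-* p (λ _ → -1ℤ) (λ s → - (x + + (q ℕ.* j)) + u i s))) ⟩
      ∏ j (λ i → ∏ p (λ _ → -1ℤ) * ∏ p (λ s → - (x + + (q ℕ.* j)) + u i s))
        ≡⟨ ∏-* j (λ _ → ∏ p (λ _ → -1ℤ)) (λ i → ∏ p (λ s → - (x + + (q ℕ.* j)) + u i s)) ⟩
      ∏ j (λ _ → ∏ p (λ _ → -1ℤ)) * F j (- (x + + (q ℕ.* j)))
        ≡⟨ cong (_* F j (- (x + + (q ℕ.* j)))) (trans (∏-const j (∏ p (λ _ → -1ℤ))) (cong (ℤ._^ j) (∏-const p -1ℤ))) ⟩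
      ε j * F j (- (x + + (q ℕ.* j))) ∎
      where
      open ≡-Reasoning
      lem : ∀ y v → y - v ≡ -1ℤ * (- y + v)
      lem = ℤ-Ring.solve-∀

    v : ℕ → ℕ → ℕ → ℤ
    v j i s = u i s * (+ (q ℕ.* j) - u i s)

    -- Pairing u with q j - u makes each factor depend on x only through x (x + q j). At x = q m
    -- this is q m · q n, where n = j + m.
    F-square : ∀ j x → F j x * F j x ≡ ∏ j (λ i → ∏ p (λ s → x * (x + + (q ℕ.* j)) + v j i s))
    F-square j x = begin
      F j x * F j x
        ≡⟨ cong (F j x *_) (F-reverse j x) ⟩
      F j x * ∏ j (λ i → ∏ p (λ s → x + + (q ℕ.* j) - u i s))
        ≡⟨ ∏-* j (λ i → ∏ p (λ s → x + u i s)) (λ i → ∏ p (λ s → x + + (q ℕ.* j) - u i s)) ⟨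
      ∏ j (λ i → ∏ p (λ s → x + u i s) * ∏ p (λ s → x + + (q ℕ.* j) - u i s))
        ≡⟨ ∏-cong j (λ i _ → trans (sym (∏-* p (λ s → x + u i s) (λ s → x + + (q ℕ.* j) - u i s)))
             (∏-cong p (λ s _ → lem x (+ (q ℕ.* j)) (u i s)))) ⟩
      ∏ j (λ i → ∏ p (λ s → x * (x + + (q ℕ.* j)) + v j i s)) ∎
      where
      open ≡-Reasoning
      lem : ∀ x y u → (x + u) * (x + y - u) ≡ x * (x + y) + u * (y - u)
      lem = ℤ-Ring.solve-∀

  +-pow-suc : ∀ q t → + (q ℕ.^ suc t) ≡ + q * + (q ℕ.^ t)
  +-pow-suc q t = ℤ.pos-* q (q ℕ.^ t)

  +-pow-+ : ∀ q s t → + (q ℕ.^ (s ℕ.+ t)) ≡ + (q ℕ.^ s) * + (q ℕ.^ t)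
  +-pow-+ q s t = trans (cong +_ (ℕ.^-distribˡ-+-* q s t)) (ℤ.pos-* (q ℕ.^ s) (q ℕ.^ t))

  ∣-*-mono : ∀ {a b c d} → a ∣ c → b ∣ d → a * b ∣ c * d
  ∣-*-mono {a} {b} (divides x refl) (divides y refl) = divides (x * y) (lem x a y b)
    where
    lem : ∀ x a y b → x * a * (y * b) ≡ x * y * (a * b)
    lem = ℤ-Ring.solve-∀

  -- C(n, j) (n - j) = n C(n-1, j) for n = j + m. Multiplication by C(n, j) thus turns the factor m
  -- of the relation for s below into a multiple of n.
  n∣[j+m]Cj*m : ∀ j m → (j ℕ.+ m) ℕ∣.∣ ((j ℕ.+ m) C j) ℕ.* m
  n∣[j+m]Cj*m j zero    = subst (j ℕ.+ 0 ℕ∣.∣_) (sym (ℕ.*-zeroʳ ((j ℕ.+ 0) C j))) ((j ℕ.+ 0) ℕ∣.∣0)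
  n∣[j+m]Cj*m j (suc m) = ℕ∣.divides ((j ℕ.+ m) C j)
    (trans (ℕ.*-comm ((j ℕ.+ suc m) C j) (suc m))
      (trans ([k+1]*[j+k+1]Cj j m) (ℕ.*-comm (j ℕ.+ suc m) ((j ℕ.+ m) C j))))

  -- Difference of squares: (F₁ - ε f)(F₁ + ε f) = M N e with first factor s N. Once N is cancelled,
  -- F₁ + ε f is written as s N + 2 ε f, to be read modulo the prime.
  cancel-difference : ∀ N .{{_ : ℤ.NonZero N}} F₁ f ε M J s e → ε * ε ≡ + 1 → M + J ≡ N →
    F₁ - ε * f ≡ s * N → F₁ * F₁ ≡ f * f + M * (M + J) * e →
    s * (s * N + + 2 * (ε * f)) ≡ M * e
  cancel-difference N F₁ f ε M J s e ε² M+J D≡ sq = ℤ.*-cancelʳ-≡ _ _ N (begin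
    s * (s * N + + 2 * (ε * f)) * N                ≡⟨ lem₁ s N (ε * f) ⟩
    s * N * (s * N + + 2 * (ε * f))                ≡⟨ cong (λ d → d * (d + + 2 * (ε * f))) D≡ ⟨
    (F₁ - ε * f) * (F₁ - ε * f + + 2 * (ε * f))    ≡⟨ lem₂ F₁ ε f ⟩
    F₁ * F₁ - (ε * ε) * (f * f)                    ≡⟨ cong₂ (λ a b → a - b * (f * f)) sq ε² ⟩
    (f * f + M * (M + J) * e) - + 1 * (f * f)      ≡⟨ lem₃ (f * f) M (M + J) e ⟩
    M * e * (M + J)                                ≡⟨ cong (M * e *_) M+J ⟩
    M * e * N                                      ∎)
    where
    open ≡-Reasoning
    lem₁ : ∀ s n f → s * (s * n + + 2 * f) * n ≡ s * n * (s * n + + 2 * f)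
    lem₁ = ℤ-Ring.solve-∀
    lem₂ : ∀ a b c → (a - b * c) * (a - b * c + + 2 * (b * c)) ≡ a * a - (b * b) * (c * c)
    lem₂ = ℤ-Ring.solve-∀
    lem₃ : ∀ f a b e → (f + a * b * e) - + 1 * f ≡ a * e * b
    lem₃ = ℤ-Ring.solve-∀

  -- These are the D_j of the overview.
  coeff-diff : ℕ → ℕ → ℕ → ℤ
  coeff-diff p n j = -1ℤ ℤ.^ (p ℕ.* j) * + ((p ℕ.* n) C (p ℕ.* j)) - -1ℤ ℤ.^ j * + (n C j)

  module PrimeBlocks {p : ℕ} (pr : Prime (suc p)) where
    open Blocks p

    q∤1 : ¬ (+ q ∣ + 1)
    q∤1 d = ¬prime[1] (subst Prime (ℕ∣.∣1⇒≡1 (∣⇒∣ᵤ d)) pr)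

    q∤suc : ∀ {s} → s ℕ.< p → ¬ (+ q ∣ + suc s)
    q∤suc s<p d = ℕ.<⇒≱ (s≤s s<p) (ℕ∣.∣⇒≤ (∣⇒∣ᵤ d))

    u-mod : ∀ i s → + q ∣ u i s - + suc s
    u-mod i s = divides (+ i) (begin
      + (q ℕ.* i ℕ.+ suc s) - + suc s    ≡⟨ cong (λ a → a + + suc s - + suc s) (ℤ.pos-* q i) ⟩
      + q * + i + + suc s - + suc s      ≡⟨ lem (+ q) (+ i) (+ suc s) ⟩
      + i * + q                          ∎)
      where
      open ≡-Reasoning
      lem : ∀ q i s → q * i + s - s ≡ i * q
      lem = ℤ-Ring.solve-∀

    F0 : ℕ → ℤ
    F0 j = F j (+ 0)

    q∤F0 : ∀ j → ¬ (+ q ∣ F0 j)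
    q∤F0 j = ∏-∤ pr q∤1 j (λ i _ → ∏-∤ pr q∤1 p (λ s s<p d → q∤suc s<p (subst (+ q ∣_) (lem (u i s) (+ suc s))
      (∣m∣n⇒∣m-n d (u-mod i s)))))
      where
      lem : ∀ a b → + 0 + a - (a - b) ≡ b
      lem = ℤ-Ring.solve-∀

    -- x = V + z e with e ≡ V σ modulo q; for V a product of units, σ is the
    -- sum of their inverses.
    Linear : ℤ → ℤ → ℤ → ℤ → Set
    Linear z x V σ = ∃ λ e → x ≡ V + z * e × + q ∣ e - V * σ

    Linear-* : ∀ {z x V σ x′ V′ σ′} → + q ∣ z → Linear z x V σ → Linear z x′ V′ σ′ →
               Linear z (x * x′) (V * V′) (σ + σ′)
    Linear-* {z} {x} {V} {σ} {x′} {V′} {σ′} q∣z (e , x≡ , q∣) (e′ , x′≡ , q∣′) =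
      V * e′ + V′ * e + z * (e * e′) ,
      trans (cong₂ _*_ x≡ x′≡) (lem₁ V V′ z e e′) ,
      subst (+ q ∣_) (lem₂ V V′ z e e′ σ σ′)
        (∣m∣n⇒∣m+n (∣m∣n⇒∣m+n (∣n⇒∣m*n V q∣′) (∣n⇒∣m*n V′ q∣)) (∣m⇒∣m*n (e * e′) q∣z))
      where
      lem₁ : ∀ V V′ z e e′ → (V + z * e) * (V′ + z * e′) ≡ V * V′ + z * (V * e′ + V′ * e + z * (e * e′))
      lem₁ = ℤ-Ring.solve-∀
      lem₂ : ∀ V V′ z e e′ σ σ′ → V * (e′ - V′ * σ′) + V′ * (e - V * σ) + z * (e * e′)
           ≡ V * e′ + V′ * e + z * (e * e′) - V * V′ * (σ + σ′)
      lem₂ = ℤ-Ring.solve-∀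

    Linear-∏ : ∀ {z} → + q ∣ z → ∀ n {x V σ : ℕ → ℤ} →
               (∀ k → k ℕ.< n → Linear z (x k) (V k) (σ k)) → Linear z (∏ n x) (∏ n V) (∑ n σ)
    Linear-∏ {z} q∣z zero    lin = + 0 , sym (trans (cong (_+_ (+ 1)) (ℤ.*-zeroʳ z)) refl) , divides (+ 0) refl
    Linear-∏ {z} q∣z (suc n) {x} {V} {σ} lin =
      Linear-* {z} {x 0} {V 0} {σ 0} {∏ n (x ∘ suc)} {∏ n (V ∘ suc)} {∑ n (σ ∘ suc)} q∣z
        (lin 0 (s≤s z≤n)) (Linear-∏ q∣z n (λ k k<n → lin (suc k) (s≤s k<n)))

    w : ℕ → ℤ
    w s = - (+ suc s) ℤ.^ (p ℕ.∸ 2)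

    -- The inverse of −t² modulo q is −t^{q−3}, by Fermat.
    v*w : ∀ j i s → s ℕ.< p → + q ∣ + 1 - v j i s * w s
    v*w j i s s<p = subst (+ q ∣_) (lem (v j i s * w s) t²y)
      (∣m⇒∣-m (∣m∣n⇒∣m+n vw≡t²y (t²y≡1 s s<p)))
      where
      t y t²y : ℤ
      t = + suc s
      y = t ℤ.^ (p ℕ.∸ 2)
      t²y = t * (t * y)
      lem : ∀ a b → - (a - b + (b - + 1)) ≡ + 1 - a
      lem = ℤ-Ring.solve-∀
      t²y≡1 : ∀ s → s ℕ.< p → + q ∣ + suc s * (+ suc s * (+ suc s) ℤ.^ (p ℕ.∸ 2)) - + 1
      t²y≡1 = go p (λ s s<p → fermat pr (suc s) (q∤suc s<p))
        where
        go : ∀ p′ → (∀ s → s ℕ.< p′ → + q ∣ (+ suc s) ℤ.^ p′ - + 1) →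
             ∀ s → s ℕ.< p′ → + q ∣ + suc s * (+ suc s * (+ suc s) ℤ.^ (p′ ℕ.∸ 2)) - + 1
        -- For q = 2 the exponent p′ ∸ 2 truncates to 0 and only t = 1 occurs. From q = 3 on, t · (t
        -- · t^{p′ ∸ 2}) is t^{p′} by computation.
        go (suc zero)     _ zero    _   = divides (+ 0) refl
        go (suc zero)     _ (suc s) (s≤s ())
        go (suc (suc p′)) f s       s<p = f s s<p
      v≡ : + q ∣ v j i s - t * (- t)
      v≡ = ∣-*-cong {a = u i s} {b = t} {c = + (q ℕ.* j) - u i s} {e = - t} (u-mod i s)
        (subst (+ q ∣_) (lem′ (+ (q ℕ.* j)) (u i s) t)
          (∣m∣n⇒∣m-n (divides (+ j) (trans (ℤ.pos-* q j) (ℤ.*-comm (+ q) (+ j)))) (u-mod i s)))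
        where
        lem′ : ∀ a u t → a - (u - t) ≡ a - u - - t
        lem′ = ℤ-Ring.solve-∀
      vw≡t²y : + q ∣ v j i s * w s - t²y
      vw≡t²y = subst (+ q ∣_) (lem′ (v j i s) t y) (∣m⇒∣-m (∣m⇒∣m*n y v≡))
        where
        lem′ : ∀ v t y → - ((v - t * - t) * y) ≡ v * - y - t * (t * y)
        lem′ = ℤ-Ring.solve-∀

    -- The bound makes the exponent q - 3 positive, so the additional term s = 0 of the power sum
    -- vanishes; `∑-power` applies because q - 3 < q - 1. For q = 3 the exponent is 0 and the sum is
    -- not 0 modulo 3, hence the smaller value of δ.
    ∑w : 3 ℕ.≤ p → + q ∣ ∑ p w
    ∑w 3≤p = subst (+ q ∣_) (lem 3≤p) (∣m⇒∣-m (∑-power pr (p ℕ.∸ 2) 0 (s≤s (bound 3≤p))))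
      where
      bound : ∀ {p} → 3 ℕ.≤ p → suc (p ℕ.∸ 2) ℕ.≤ p
      bound (s≤s (s≤s {_} {p} _)) = s≤s (ℕ.n≤1+n p)
      lem : ∀ {p′} → 3 ℕ.≤ p′ → - ∑ (suc p′) (λ s → (+ s) ℤ.^ (p′ ℕ.∸ 2) * + (s C 0)) ≡ ∑ p′ (λ s → - (+ suc s) ℤ.^ (p′ ℕ.∸ 2))
      lem (s≤s (s≤s (s≤s {_} {k} _))) = begin
        - (+ 0 + ∑ p′ (λ s → (+ suc s) ℤ.^ suc k * + 1))
          ≡⟨ cong -_ (trans (ℤ.+-identityˡ (∑ p′ (λ s → (+ suc s) ℤ.^ suc k * + 1)))
               (∑-cong p′ (λ s _ → ℤ.*-identityʳ ((+ suc s) ℤ.^ suc k)))) ⟩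
        - ∑ p′ (λ s → (+ suc s) ℤ.^ suc k)
          ≡⟨ ℤ.-1*i≡-i (∑ p′ (λ s → (+ suc s) ℤ.^ suc k)) ⟨
        -1ℤ * ∑ p′ (λ s → (+ suc s) ℤ.^ suc k)
          ≡⟨ ∑-*ˡ p′ -1ℤ (λ s → (+ suc s) ℤ.^ suc k) ⟨
        ∑ p′ (λ s → -1ℤ * (+ suc s) ℤ.^ suc k)
          ≡⟨ ∑-cong p′ (λ s _ → ℤ.-1*i≡-i ((+ suc s) ℤ.^ suc k)) ⟩
        ∑ p′ (λ s → - (+ suc s) ℤ.^ suc k) ∎
        where
        open ≡-Reasoning
        p′ : ℕ
        p′ = suc (suc (suc k))

    F-square-diff : ∀ j x → + q ∣ x →
      ∃ λ e → F j x * F j x ≡ F0 j * F0 j + x * (x + + (q ℕ.* j)) * e × (3 ℕ.≤ p → + q ∣ e)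
    F-square-diff j x q∣x =
      proj₁ lin ,
      trans (F-square j x) (trans (proj₁ (proj₂ lin)) (cong (_+ z * proj₁ lin) (sym V≡))) ,
      λ 3≤p → ∣m+n∣n⇒∣m {m = proj₁ lin} {n = - (V * σ)} (proj₂ (proj₂ lin))
                (∣m⇒∣-m (∣n⇒∣m*n V (∑-∣ j (λ _ _ → ∑w 3≤p))))
      where
      z V σ : ℤ
      z = x * (x + + (q ℕ.* j))
      V = ∏ j (λ i → ∏ p (v j i))
      σ = ∑ j (λ _ → ∑ p w)
      q∣z : + q ∣ z
      q∣z = ∣m⇒∣m*n (x + + (q ℕ.* j)) q∣x
      lin : Linear z (∏ j (λ i → ∏ p (λ s → z + v j i s))) V σ
      -- A single factor z + v has V = v and e = 1, and its σ is the inverse `w s` of v modulo q.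
      lin = Linear-∏ {z} q∣z j (λ i _ → Linear-∏ {z} q∣z p (λ s s<p →
        + 1 , trans (ℤ.+-comm z (v j i s)) (cong (_+_ (v j i s)) (sym (ℤ.*-identityʳ z))) , v*w j i s s<p))
      V≡ : F0 j * F0 j ≡ V
      V≡ = trans (F-square j (+ 0)) (∏-cong j (λ i _ → ∏-cong p (λ s _ → ℤ.+-identityˡ (v j i s))))

    ε*ε : ∀ j → ε j * ε j ≡ + 1
    ε*ε j = squares (-1ℤ ℤ.^ p) (squares -1ℤ refl p) j
      where
      squares : ∀ a → a * a ≡ + 1 → ∀ n → a ℤ.^ n * a ℤ.^ n ≡ + 1
      squares a a² zero    = refl
      squares a a² (suc n) = trans (lem a (a ℤ.^ n)) (cong₂ _*_ a² (squares a a² n))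
        where
        lem : ∀ a b → a * b * (a * b) ≡ a * a * (b * b)
        lem = ℤ-Ring.solve-∀

    q∤ε*F0 : ∀ j → ¬ (+ q ∣ ε j * F0 j)
    q∤ε*F0 j d with euclid pr (ε j) (F0 j) d
    ... | inj₁ q∣ε  = q∤1 (subst (+ q ∣_) (ε*ε j) (∣m⇒∣m*n (ε j) q∣ε))
    ... | inj₂ q∣F0 = q∤F0 j q∣F0

    -- Reflection carries q m to -q n with n = j + m, and the polynomial F j takes congruent values
    -- at -q n and 0 modulo q n.
    F-diff : ∀ j m → + (q ℕ.* (j ℕ.+ m)) ∣ F j (+ (q ℕ.* m)) - ε j * F0 j
    F-diff j m = subst (λ x → + N ∣ x - ε j * F0 j)
      (sym (trans (F-reflect j (+ (q ℕ.* m))) (cong (λ x → ε j * F j (- x)) qm+qj)))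
      (subst (+ N ∣_) (lem (ε j) (F j (- + N)) (F0 j))
        (∣n⇒∣m*n (ε j) (∏-∣-cong j (λ i → ∏-∣-cong p (λ s → divides -1ℤ (lem′ (+ N) (u i s)))))))
      where
      N : ℕ
      N = q ℕ.* (j ℕ.+ m)
      qm+qj : + (q ℕ.* m) + + (q ℕ.* j) ≡ + N
      qm+qj = cong +_ (trans (ℕ.+-comm (q ℕ.* m) (q ℕ.* j)) (sym (ℕ.*-distribˡ-+ q j m)))
      lem : ∀ a b c → a * (b - c) ≡ a * b - a * c
      lem = ℤ-Ring.solve-∀
      lem′ : ∀ n u → (- n + u) - (+ 0 + u) ≡ -1ℤ * n
      lem′ = ℤ-Ring.solve-∀

    F-diff-quotient : ∀ j m .{{_ : NonZero (j ℕ.+ m)}} →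
      ∃ λ s → ∃ λ e →
        F j (+ (q ℕ.* m)) - ε j * F0 j ≡ s * + (q ℕ.* (j ℕ.+ m)) ×
        s * (s * + (q ℕ.* (j ℕ.+ m)) + + 2 * (ε j * F0 j)) ≡ + (q ℕ.* m) * e ×
        (3 ℕ.≤ p → + q ∣ e)
    F-diff-quotient j m =
      quotient (F-diff j m) , proj₁ sq , _∣_.equality (F-diff j m) ,
      cancel-difference (+ (q ℕ.* (j ℕ.+ m))) {{ℕ.m*n≢0 q (j ℕ.+ m)}} (F j (+ (q ℕ.* m))) (F0 j) (ε j)
        (+ (q ℕ.* m)) (+ (q ℕ.* j)) (quotient (F-diff j m)) (proj₁ sq) (ε*ε j)
        qm+qj (_∣_.equality (F-diff j m)) (proj₁ (proj₂ sq)) ,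
      proj₂ (proj₂ sq)
      where
      sq : ∃ λ e → F j (+ (q ℕ.* m)) * F j (+ (q ℕ.* m)) ≡
             F0 j * F0 j + + (q ℕ.* m) * (+ (q ℕ.* m) + + (q ℕ.* j)) * e × (3 ℕ.≤ p → + q ∣ e)
      sq = F-square-diff j (+ (q ℕ.* m)) (divides (+ m) (trans (ℤ.pos-* q m) (ℤ.*-comm (+ q) (+ m))))
      qm+qj : + (q ℕ.* m) + + (q ℕ.* j) ≡ + (q ℕ.* (j ℕ.+ m))
      qm+qj = cong +_ (trans (ℕ.+-comm (q ℕ.* m) (q ℕ.* j)) (sym (ℕ.*-distribˡ-+ q j m)))

    -- Multiply the relation for s by C(n, j). Then C(n, j) m supplies q^w, the factor q of q m one
    -- more q, and e another when q ≥ 5. The cofactor s q n + 2 ε F is a unit modulo odd q; for q =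
    -- 2 it is even and uses up the extra factor. This is the origin of the three values of δ.
    C*quotient : ∀ w j m s e → + (q ℕ.^ w) ∣ + (j ℕ.+ m) →
      s * (s * + (q ℕ.* (j ℕ.+ m)) + + 2 * (ε j * F0 j)) ≡ + (q ℕ.* m) * e →
      (3 ℕ.≤ p → + q ∣ e) → + (q ℕ.^ (w ℕ.+ δ q)) ∣ + ((j ℕ.+ m) C j) * s
    C*quotient w j m s e q^w∣n eq q∣e = cases p refl
      where
      n : ℕ
      n = j ℕ.+ m
      c εF B : ℤ
      c = + (n C j)
      εF = ε j * F0 j
      B = s * + (q ℕ.* n) + + 2 * εF
      q^w∣cm : + (q ℕ.^ w) ∣ c * + m
      q^w∣cm = ∣-trans q^w∣n (subst (+ n ∣_) (ℤ.pos-* (n C j) m) (∣ᵤ⇒∣ (n∣[j+m]Cj*m j m)))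
      csB : c * s * B ≡ c * + m * (+ q * e)
      csB = trans (ℤ.*-assoc c s B) (trans (cong (c *_) (trans eq (cong (_* e) (ℤ.pos-* q m)))) (lem c (+ q) (+ m) e))
        where
        lem : ∀ c q m e → c * (q * m * e) ≡ c * m * (q * e)
        lem = ℤ-Ring.solve-∀
      odd : 2 ℕ.≤ p → ¬ (+ q ∣ B)
      odd 2≤p d with euclid pr (+ 2) εF (∣m+n∣m⇒∣n {m = s * + (q ℕ.* n)} d
                       (∣n⇒∣m*n s (divides (+ n) (trans (ℤ.pos-* q n) (ℤ.*-comm (+ q) (+ n))))))
      ... | inj₁ q∣2 = ℕ.<⇒≱ (s≤s 2≤p) (ℕ∣.∣⇒≤ (∣⇒∣ᵤ q∣2))
      ... | inj₂ q∣F = q∤ε*F0 j q∣F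
      large : ∀ d → 2 ℕ.≤ p → + (q ℕ.^ d) ∣ + q * e → + (q ℕ.^ (w ℕ.+ d)) ∣ c * s
      large d 2≤p q^d∣ = ^-∣-cancel pr (w ℕ.+ d) B (odd 2≤p)
        (subst (+ (q ℕ.^ (w ℕ.+ d)) ∣_) (sym csB)
          (subst (_∣ c * + m * (+ q * e)) (sym (+-pow-+ q w d)) (∣-*-mono q^w∣cm q^d∣)))
      small : p ≡ 1 → ∀ w → + (q ℕ.^ w) ∣ + n → + (q ℕ.^ w) ∣ c * + m → + (q ℕ.^ w) ∣ c * s
      -- For q = 2 half of the cofactor, s n + ε F, is odd as soon as n is even. The case w = 0,
      -- where n may be odd, claims nothing and is split off.
      small p≡1 zero    _     _      = divides (c * s) (sym (ℤ.*-identityʳ (c * s)))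
      small p≡1 (suc w) q^∣n q^∣cm =
        ^-∣-cancel pr (suc w) (s * + n + εF) even
          (subst (+ (q ℕ.^ suc w) ∣_) (sym half) (∣m⇒∣m*n e q^∣cm))
        where
        even : ¬ (+ q ∣ s * + n + εF)
        even d = q∤ε*F0 j (∣m+n∣m⇒∣n {m = s * + n} d (∣n⇒∣m*n s (∣-trans
          (divides (+ (q ℕ.^ w)) (trans (ℤ.pos-* q (q ℕ.^ w)) (ℤ.*-comm (+ q) (+ (q ℕ.^ w))))) q^∣n)))
        half : c * s * (s * + n + εF) ≡ c * + m * e
        half = ℤ.*-cancelˡ-≡ (+ 2) _ _ (begin
          + 2 * (c * s * (s * + n + εF))            ≡⟨ lem₁ c s (+ n) εF ⟩
          c * (s * (s * (+ 2 * + n) + + 2 * εF))    ≡⟨ cong (λ x → c * (s * (s * x + + 2 * εF))) (trans (sym (ℤ.pos-* 2 n)) (cong (λ x → + (suc x ℕ.* n)) (sym p≡1))) ⟩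
          c * (s * B)                               ≡⟨ ℤ.*-assoc c s B ⟨
          c * s * B                                 ≡⟨ csB ⟩
          c * + m * (+ q * e)                       ≡⟨ cong (λ x → c * + m * (+ suc x * e)) p≡1 ⟩
          c * + m * (+ 2 * e)                       ≡⟨ lem₂ c (+ m) e ⟩
          + 2 * (c * + m * e)                       ∎)
          where
          open ≡-Reasoning
          lem₁ : ∀ c s n f → + 2 * (c * s * (s * n + f)) ≡ c * (s * (s * (+ 2 * n) + + 2 * f))
          lem₁ = ℤ-Ring.solve-∀
          lem₂ : ∀ c m e → c * m * (+ 2 * e) ≡ + 2 * (c * m * e)
          lem₂ = ℤ-Ring.solve-∀
      cases : ∀ p′ → p′ ≡ p → + (q ℕ.^ (w ℕ.+ δ (suc p′))) ∣ c * s
      cases 0 p≡ = ⊥-elim (¬prime[1] (subst (λ k → Prime (suc k)) (sym p≡) pr))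
      cases 1 p≡ = subst (λ k → + (q ℕ.^ k) ∣ c * s) (sym (ℕ.+-identityʳ w)) (small (sym p≡) w q^w∣n q^w∣cm)
      cases 2 p≡ = large 1 (ℕ.≤-reflexive p≡)
        (subst (_∣ + q * e) (cong +_ (sym (ℕ.*-identityʳ q))) (∣m⇒∣m*n e (∣-refl {+ q})))
      cases (suc (suc (suc k))) p≡ = large 2 (subst (2 ℕ.≤_) p≡ (s≤s (s≤s z≤n)))
        (subst (_∣ + q * e) (trans (sym (ℤ.pos-* q q)) (cong (λ x → + (q ℕ.* x)) (sym (ℕ.*-identityʳ q))))
          (*-monoʳ-∣ (+ q) {x = + q} {y = e} (q∣e (subst (3 ℕ.≤_) p≡ (s≤s (s≤s (s≤s z≤n)))))))

    -- Times F j 0, a unit modulo q, the difference is C(n, j) s · q n: w + δ factors q come from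
    -- C(n, j) s and w + 1 from q n.
    C-congruence : ∀ w j m .{{_ : NonZero (j ℕ.+ m)}} → + (q ℕ.^ w) ∣ + (j ℕ.+ m) →
      + (q ℕ.^ suc (2 ℕ.* w ℕ.+ δ q)) ∣ + ((q ℕ.* (j ℕ.+ m)) C (q ℕ.* j)) - ε j * + ((j ℕ.+ m) C j)
    C-congruence w j m q^w∣n = ^-∣-cancel pr (suc (2 ℕ.* w ℕ.+ δ q)) (F0 j) (q∤F0 j)
      (subst (+ (q ℕ.^ suc (2 ℕ.* w ℕ.+ δ q)) ∣_) (sym expand)
        (subst (_∣ c * s * (+ q * + n)) (sym power)
          (∣-*-mono (C*quotient w j m s e q^w∣n (proj₁ (proj₂ (proj₂ (proj₂ Q)))) (proj₂ (proj₂ (proj₂ (proj₂ Q))))) (*-monoʳ-∣ (+ q) {x = + (q ℕ.^ w)} {y = + n} q^w∣n))))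
      where
      open ≡-Reasoning
      n : ℕ
      n = j ℕ.+ m
      Q : ∃ λ s → ∃ λ e →
        F j (+ (q ℕ.* m)) - ε j * F0 j ≡ s * + (q ℕ.* n) ×
        s * (s * + (q ℕ.* n) + + 2 * (ε j * F0 j)) ≡ + (q ℕ.* m) * e ×
        (3 ℕ.≤ p → + q ∣ e)
      Q = F-diff-quotient j m
      s e c c′ : ℤ
      s = proj₁ Q
      e = proj₁ (proj₂ Q)
      c = + (n C j)
      c′ = + ((q ℕ.* n) C (q ℕ.* j))
      D≡ : F j (+ (q ℕ.* m)) - ε j * F0 j ≡ s * + (q ℕ.* n)
      D≡ = proj₁ (proj₂ (proj₂ Q))
      power : + (q ℕ.^ suc (2 ℕ.* w ℕ.+ δ q)) ≡ + (q ℕ.^ (w ℕ.+ δ q)) * (+ q * + (q ℕ.^ w))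
      power = trans (cong (λ k → + (q ℕ.^ k)) (lem w (δ q)))
        (trans (+-pow-+ q (w ℕ.+ δ q) (suc w)) (cong (+ (q ℕ.^ (w ℕ.+ δ q)) *_) (+-pow-suc q w)))
        where
        lem : ∀ w d → suc (2 ℕ.* w ℕ.+ d) ≡ w ℕ.+ d ℕ.+ suc w
        lem = ℕ-Ring.solve-∀
      expand : (c′ - ε j * c) * F0 j ≡ c * s * (+ q * + n)
      expand = begin
        (c′ - ε j * c) * F0 j               ≡⟨ lem₁ c′ (ε j) c (F0 j) ⟩
        c′ * F0 j - c * (ε j * F0 j)        ≡⟨ cong (_- c * (ε j * F0 j)) (C-F j m) ⟩
        c * F j (+ (q ℕ.* m)) - c * (ε j * F0 j) ≡⟨ lem₂ c (F j (+ (q ℕ.* m))) (ε j * F0 j) ⟩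
        c * (F j (+ (q ℕ.* m)) - ε j * F0 j) ≡⟨ cong (c *_) (trans D≡ (cong (s *_) (ℤ.pos-* q n))) ⟩
        c * (s * (+ q * + n))               ≡⟨ ℤ.*-assoc c s (+ q * + n) ⟨
        c * s * (+ q * + n)                 ∎
        where
        lem₁ : ∀ a b c f → (a - b * c) * f ≡ a * f - c * (b * f)
        lem₁ = ℤ-Ring.solve-∀
        lem₂ : ∀ a b c → a * b - a * c ≡ a * (b - c)
        lem₂ = ℤ-Ring.solve-∀

    coeff-diff-∣ : ∀ w n .{{_ : NonZero n}} → + (q ℕ.^ w) ∣ + n → ∀ j → j ℕ.≤ n →
      + (q ℕ.^ suc (2 ℕ.* w ℕ.+ δ q)) ∣ coeff-diff q n j
    coeff-diff-∣ w n q^w∣n j j≤n with ℕ.m≤n⇒∃[o]m+o≡n j≤n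
    ... | m , refl = subst (+ (q ℕ.^ suc (2 ℕ.* w ℕ.+ δ q)) ∣_) (sym eq)
      (∣n⇒∣m*n (-1ℤ ℤ.^ (q ℕ.* j)) (C-congruence w j m q^w∣n))
      where
      open ≡-Reasoning
      c c′ : ℤ
      c = + ((j ℕ.+ m) C j)
      c′ = + ((q ℕ.* (j ℕ.+ m)) C (q ℕ.* j))
      sign : -1ℤ ℤ.^ (q ℕ.* j) ≡ -1ℤ ℤ.^ j * ε j
      sign = trans (ℤ.^-distribˡ-+-* -1ℤ j (p ℕ.* j))
        (cong (-1ℤ ℤ.^ j *_) (sym (ℤ.^-*-assoc -1ℤ p j)))
      eq : -1ℤ ℤ.^ (q ℕ.* j) * c′ - -1ℤ ℤ.^ j * c ≡ -1ℤ ℤ.^ (q ℕ.* j) * (c′ - ε j * c)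
      eq = begin
        -1ℤ ℤ.^ (q ℕ.* j) * c′ - -1ℤ ℤ.^ j * c
          ≡⟨ cong (λ x → -1ℤ ℤ.^ (q ℕ.* j) * c′ - -1ℤ ℤ.^ j * x)
               (trans (sym (ℤ.*-identityˡ c)) (cong (_* c) (sym (ε*ε j)))) ⟩
        -1ℤ ℤ.^ (q ℕ.* j) * c′ - -1ℤ ℤ.^ j * (ε j * ε j * c)
          ≡⟨ lem₁ (-1ℤ ℤ.^ (q ℕ.* j) * c′) (-1ℤ ℤ.^ j) (ε j) c ⟩
        -1ℤ ℤ.^ (q ℕ.* j) * c′ - -1ℤ ℤ.^ j * ε j * (ε j * c)
          ≡⟨ cong (λ x → -1ℤ ℤ.^ (q ℕ.* j) * c′ - x * (ε j * c)) sign ⟨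
        -1ℤ ℤ.^ (q ℕ.* j) * c′ - -1ℤ ℤ.^ (q ℕ.* j) * (ε j * c)
          ≡⟨ lem₂ (-1ℤ ℤ.^ (q ℕ.* j)) c′ (ε j * c) ⟩
        -1ℤ ℤ.^ (q ℕ.* j) * (c′ - ε j * c) ∎
        where
        lem₁ : ∀ a b e c → a - b * (e * e * c) ≡ a - b * e * (e * c)
        lem₁ = ℤ-Ring.solve-∀
        lem₂ : ∀ a b c → a * b - a * c ≡ a * (b - c)
        lem₂ = ℤ-Ring.solve-∀

  -- Polynomials in the shift operator, kept as syntax: two of them are
  -- identified when they act identically on all sequences ℤ → ℤ.
  data ShiftPoly : Set where
    X       : ShiftPoly
    con     : ℤ → ShiftPoly
    _⊕_ _⊗_ : ShiftPoly → ShiftPoly → ShiftPoly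

  act : ShiftPoly → (ℤ → ℤ) → ℤ → ℤ
  act X       F s = F (s + + 1)
  act (con c) F s = c * F s
  act (f ⊕ g) F s = act f F s + act g F s
  act (f ⊗ g) F s = act f (act g F) s

  act-cong : ∀ f {F G} → (∀ s → F s ≡ G s) → ∀ s → act f F s ≡ act f G s
  act-cong X       F≡G s = F≡G _
  act-cong (con c) F≡G s = cong (c *_) (F≡G s)
  act-cong (f ⊕ g) F≡G s = cong₂ _+_ (act-cong f F≡G s) (act-cong g F≡G s)
  act-cong (f ⊗ g) F≡G s = act-cong f (act-cong g F≡G) s

  act-+ : ∀ f F G s → act f (λ s → F s + G s) s ≡ act f F s + act f G s
  act-+ X       F G s = refl
  act-+ (con c) F G s = ℤ.*-distribˡ-+ c (F s) (G s)
  act-+ (f ⊕ g) F G s =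
    trans (cong₂ _+_ (act-+ f F G s) (act-+ g F G s)) (interchange (act f F s) _ _ _)
    where
    interchange : ∀ a b c d → (a + b) + (c + d) ≡ (a + c) + (b + d)
    interchange = ℤ-Ring.solve-∀
  act-+ (f ⊗ g) F G s = trans (act-cong f (act-+ g F G) s) (act-+ f (act g F) (act g G) s)

  act-* : ∀ f c F s → act f (λ s → c * F s) s ≡ c * act f F s
  act-* X       c F s = refl
  act-* (con d) c F s = swap d c (F s)
    where
    swap : ∀ a b x → a * (b * x) ≡ b * (a * x)
    swap = ℤ-Ring.solve-∀
  act-* (f ⊕ g) c F s =
    trans (cong₂ _+_ (act-* f c F s) (act-* g c F s)) (sym (ℤ.*-distribˡ-+ c _ _))
  act-* (f ⊗ g) c F s = trans (act-cong f (act-* g c F) s) (act-* f c (act g F) s)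

  act-shift : ∀ f F s → act f F (s + + 1) ≡ act f (act X F) s
  act-shift X       F s = refl
  act-shift (con c) F s = refl
  act-shift (f ⊕ g) F s = cong₂ _+_ (act-shift f F s) (act-shift g F s)
  act-shift (f ⊗ g) F s = trans (act-shift f (act g F) s) (act-cong f (act-shift g F) s)

  -- Translation invariance (`act-shift`) and homogeneity (`act-*`) are the two generator cases;
  -- additivity handles sums.
  act-comm : ∀ f g F s → act f (act g F) s ≡ act g (act f F) s
  act-comm X       g F s = act-shift g F s
  act-comm (con c) g F s = sym (act-* g c F s)
  act-comm (f ⊕ h) g F s =
    trans (cong₂ _+_ (act-comm f g F s) (act-comm h g F s)) (sym (act-+ g (act f F) (act h F) s))
  act-comm (f ⊗ h) g F s =
    trans (act-cong f (act-comm h g F) s) (act-comm f g (act h F) s)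

  act-∣ : ∀ {d} f {F} → (∀ s → d ∣ F s) → ∀ s → d ∣ act f F s
  act-∣ X       d∣F s = d∣F _
  act-∣ (con c) d∣F s = ∣n⇒∣m*n c (d∣F s)
  act-∣ (f ⊕ g) d∣F s = ∣m∣n⇒∣m+n (act-∣ f d∣F s) (act-∣ g d∣F s)
  act-∣ (f ⊗ g) d∣F s = act-∣ f (act-∣ g d∣F) s

  infix 4 _≋_
  record _≋_ (f g : ShiftPoly) : Set where
    constructor ≋-intro
    field same : ∀ F s → act f F s ≡ act g F s
  open _≋_

  shiftPolySemiring : CommutativeSemiring 0ℓ 0ℓ
  shiftPolySemiring = record
    { Carrier = ShiftPoly
    ; _≈_     = _≋_
    ; _+_     = _⊕_
    ; _*_     = _⊗_
    ; 0#      = con (+ 0)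
    ; 1#      = con (+ 1)
    ; isCommutativeSemiring = isCommutativeSemiringˡ record
      { +-isCommutativeMonoid = record
        { isMonoid = record
          { isSemigroup = record
            { isMagma = record
              { isEquivalence = isEquiv
              ; ∙-cong        = λ f≋g h≋k → ≋-intro λ F s → cong₂ _+_ (same f≋g F s) (same h≋k F s)
              }
            ; assoc = λ f g h → ≋-intro λ F s → ℤ.+-assoc (act f F s) _ _
            }
          ; identity = (λ f → ≋-intro λ F s → ℤ.+-identityˡ _) , (λ f → ≋-intro λ F s → ℤ.+-identityʳ _)
          }
        ; comm = λ f g → ≋-intro λ F s → ℤ.+-comm (act f F s) _
        }
      ; *-isCommutativeMonoid = record
        { isMonoid = record
          { isSemigroup = record
            { isMagma = record
              { isEquivalence = isEquiv
              ; ∙-cong        = λ {f} {g} {h} {k} f≋g h≋k → ≋-intro λ F s →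
                  trans (act-cong f (same h≋k F) s) (same f≋g (act k F) s)
              }
            ; assoc = λ f g h → ≋-intro λ F s → refl
            }
          ; identity = (λ f → ≋-intro λ F s → ℤ.*-identityˡ _)
                     , (λ f → ≋-intro λ F s → act-cong f (λ s → ℤ.*-identityˡ (F s)) s)
          }
        ; comm = λ f g → ≋-intro (act-comm f g)
        }
      ; distribʳ = λ f g h → ≋-intro λ F s → refl
      ; zeroˡ    = λ f → ≋-intro λ F s → refl
      }
    }
    where
    isEquiv : IsEquivalence _≋_
    isEquiv = record
      { refl  = ≋-intro λ F s → refl
      ; sym   = λ f≋g → ≋-intro λ F s → sym (same f≋g F s)
      ; trans = λ f≋g g≋h → ≋-intro λ F s → trans (same f≋g F s) (same g≋h F s)
      }

  module S = CommutativeSemiring shiftPolySemiring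
  open BinomialSeries shiftPolySemiring
  open import Algebra.Properties.CommutativeSemiring.Exp shiftPolySemiring using (^-distrib-*)
  open import Algebra.Properties.Semiring.Exp S.semiring using (^-congˡ) renaming (_^_ to _^ˢ_)
  open import Algebra.Properties.Semiring.Mult S.semiring using () renaming (_×_ to _·_)

  act-·1 : ∀ n F s → act (n · S.1#) F s ≡ + n * F s
  act-·1 zero    F s = refl
  act-·1 (suc n) F s = begin
    + 1 * F s + act (n · S.1#) F s ≡⟨ cong (_+_ (+ 1 * F s)) (act-·1 n F s) ⟩
    + 1 * F s + + n * F s          ≡⟨ ℤ.*-distribʳ-+ (F s) (+ 1) (+ n) ⟨
    + suc n * F s                  ∎
    where open ≡-Reasoning

  act-X^ : ∀ n F s → act (X ^ˢ n) F s ≡ F (s + + n)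
  act-X^ zero    F s = trans (ℤ.*-identityˡ (F s)) (cong F (sym (ℤ.+-identityʳ s)))
  act-X^ (suc n) F s =
    trans (act-X^ n F (s + + 1)) (cong F (ℤ.+-assoc s (+ 1) (+ n)))

  Δ : ShiftPoly
  Δ = X ⊕ con ℤ.-1ℤ

  1+Δ≋X : (S.1# ⊕ Δ) ≋ X
  1+Δ≋X = ≋-intro λ F s → lem (F s) (F (s + + 1))
    where
    lem : ∀ a b → + 1 * a + (b + ℤ.-1ℤ * a) ≡ b
    lem = ℤ-Ring.solve-∀

  -- Integer-valued binomial coefficients and floor division.

  falling-suc : ∀ j x → falling (x + + 1) (suc j) ≡ falling x (suc j) + + suc j * falling x j
  falling-suc zero    x = lem x
    where
    lem : ∀ x → + 1 * (x + + 1 - + 0) ≡ + 1 * (x - + 0) + + 1 * + 1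
    lem = ℤ-Ring.solve-∀
  falling-suc (suc j) x = begin
    falling (x + + 1) (suc j) * (x + + 1 - + suc j)
      ≡⟨ cong₂ _*_ (falling-suc j x) (cong (_-_ (x + + 1)) (ℤ.pos-+ 1 j)) ⟩
    (a * (x - + j) + + suc j * a) * (x + + 1 - (+ 1 + + j))
      ≡⟨ cong (λ z → (a * (x - + j) + z * a) * (x + + 1 - (+ 1 + + j))) (ℤ.pos-+ 1 j) ⟩
    (a * (x - + j) + (+ 1 + + j) * a) * (x + + 1 - (+ 1 + + j))
      ≡⟨ lem a x (+ j) ⟩
    a * (x - + j) * (x - (+ 1 + + j)) + (+ 1 + (+ 1 + + j)) * (a * (x - + j)) ∎
    where
    open ≡-Reasoning
    a : ℤ
    a = falling x j
    lem : ∀ a x j → (a * (x - j) + (+ 1 + j) * a) * (x + + 1 - (+ 1 + j))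
                  ≡ a * (x - j) * (x - (+ 1 + j)) + (+ 1 + (+ 1 + j)) * (a * (x - j))
    lem = ℤ-Ring.solve-∀

  falling-0 : ∀ j → falling (+ 0) (suc j) ≡ + 0
  falling-0 zero    = refl
  falling-0 (suc j) = cong (_* (+ 0 - + suc j)) (falling-0 j)

  -- Induction over ℤ in both directions from x = 0: by `falling-suc`, neighbouring values differ by
  -- k + 1 times a multiple of k!.
  !∣falling : ∀ k x → + (k !) ∣ falling x k
  !∣falling zero    x = divides (+ 1) refl
  !∣falling (suc k)   = go
    where
    diff : ∀ x → + (suc k !) ∣ + suc k * falling x k
    diff x = subst (_∣ + suc k * falling x k) (sym (ℤ.pos-* (suc k) (k !)))
               (*-monoʳ-∣ (+ suc k) (!∣falling k x))
    up : ∀ x → + (suc k !) ∣ falling x (suc k) → + (suc k !) ∣ falling (x + + 1) (suc k)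
    up x ∣fx = subst (+ (suc k !) ∣_) (sym (falling-suc k x)) (∣m∣n⇒∣m+n ∣fx (diff x))
    down : ∀ x → + (suc k !) ∣ falling (x + + 1) (suc k) → + (suc k !) ∣ falling x (suc k)
    down x ∣fx = ∣m+n∣n⇒∣m (subst (+ (suc k !) ∣_) (falling-suc k x) ∣fx) (diff x)
    go : ∀ x → + (suc k !) ∣ falling x (suc k)
    go (+ zero)     = divides (+ 0) (falling-0 k)
    go (+ suc n)    = subst (λ m → + (suc k !) ∣ falling (+ m) (suc k)) (ℕ.+-comm n 1) (up (+ n) (go (+ n)))
    go -[1+ zero ]  = down -[1+ 0 ] (go (+ 0))
    go -[1+ suc n ] = down -[1+ suc n ] (go -[1+ n ])

  floorDiv-unique : ∀ d .{{_ : NonZero d}} {x} q r → r ℕ.< d → x ≡ + r + q * + d → floorDiv x d ≡ q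
  floorDiv-unique d@(suc _) {x} q r r<d x≡ =
    sym (ℤ.i-j≡0⇒i≡j q q′ (ℤ.∣i∣≡0⇒i≡0 (ℕ.n<1⇒n≡0 (ℕ.*-cancelʳ-< d ℤ.∣ q - q′ ∣ 1 (begin-strict
      ℤ.∣ q - q′ ∣ ℕ.* d        ≡⟨ ℤ.abs-* (q - q′) (+ d) ⟨
      ℤ.∣ (q - q′) * + d ∣      ≡⟨ cong ℤ.∣_∣ difference ⟩
      ℤ.∣ + r′ - + r ∣          ≡⟨ cong ℤ.∣_∣ (ℤ.m-n≡m⊖n r′ r) ⟩
      ℤ.∣ r′ ℤ.⊖ r ∣            ≤⟨ ℤ.∣m⊝n∣≤m⊔n r′ r ⟩
      r′ ℕ.⊔ r                  <⟨ ℕ.⊔-lub (n%ℕd<d x d) r<d ⟩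
      d                         ≡⟨ ℕ.*-identityˡ d ⟨
      1 ℕ.* d                   ∎)))))
    where
    open ℕ.≤-Reasoning
    q′ : ℤ
    q′ = x /ℕ d
    r′ : ℕ
    r′ = x %ℕ d
    lem : ∀ a b x y e → a + x * e ≡ b + y * e → (y - x) * e ≡ a - b
    lem a b x y e eq = trans (lem₁ b x y e) (trans (cong (λ u → u - b - x * e) (sym eq)) (lem₂ a b x e))
      where
      lem₁ : ∀ b x y e → (y - x) * e ≡ (b + y * e) - b - x * e
      lem₁ = ℤ-Ring.solve-∀
      lem₂ : ∀ a b x e → (a + x * e) - b - x * e ≡ a - b
      lem₂ = ℤ-Ring.solve-∀
    difference : (q - q′) * + d ≡ + r′ - + r
    difference = lem (+ r′) (+ r) q′ q (+ d) (trans (sym (a≡a%ℕn+[a/ℕn]*n x d)) x≡)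

  floorDiv-* : ∀ d .{{_ : NonZero d}} k → floorDiv (k * + d) d ≡ k
  floorDiv-* d@(suc _) k = floorDiv-unique d k 0 (s≤s z≤n) (sym (ℤ.+-identityˡ (k * + d)))

  floorDiv-exact : ∀ d .{{_ : NonZero d}} {x} → + d ∣ x → floorDiv x d * + d ≡ x
  floorDiv-exact d (divides k refl) = cong (_* + d) (floorDiv-* d k)

  binomℤ-! : ∀ x k → binomℤ x k * + (k !) ≡ falling x k
  binomℤ-! x k = floorDiv-exact (k !) {{k ℕ.!≢0}} (!∣falling k x)

  binomℤ-pascal : ∀ x k → binomℤ (x + + 1) (suc k) ≡ binomℤ x (suc k) + binomℤ x k
  binomℤ-pascal x k = ℤ.*-cancelʳ-≡ _ _ (+ (suc k !)) {{suc k ℕ.!≢0}} (begin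
    binomℤ (x + + 1) (suc k) * + (suc k !)
      ≡⟨ binomℤ-! (x + + 1) (suc k) ⟩
    falling (x + + 1) (suc k)
      ≡⟨ falling-suc k x ⟩
    falling x (suc k) + + suc k * falling x k
      ≡⟨ cong₂ (λ u v → u + + suc k * v) (binomℤ-! x (suc k)) (binomℤ-! x k) ⟨
    a * + (suc k !) + + suc k * (b * + (k !))
      ≡⟨ cong (λ u → a * u + + suc k * (b * + (k !))) (ℤ.pos-* (suc k) (k !)) ⟩
    a * (+ suc k * + (k !)) + + suc k * (b * + (k !))
      ≡⟨ lem a b (+ suc k) (+ (k !)) ⟩
    (a + b) * (+ suc k * + (k !))
      ≡⟨ cong ((a + b) *_) (ℤ.pos-* (suc k) (k !)) ⟨
    (a + b) * + (suc k !) ∎)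
    where
    open ≡-Reasoning
    a b : ℤ
    a = binomℤ x (suc k)
    b = binomℤ x k
    lem : ∀ a b k f → a * (k * f) + k * (b * f) ≡ (a + b) * (k * f)
    lem = ℤ-Ring.solve-∀

  binomℤ-0ˡ : ∀ k → binomℤ (+ 0) (suc k) ≡ + 0
  binomℤ-0ˡ k = ℤ.*-cancelʳ-≡ _ _ (+ (suc k !)) {{suc k ℕ.!≢0}} (trans (binomℤ-! (+ 0) (suc k)) (falling-0 k))

  binomℤ-pos : ∀ n k → binomℤ (+ n) k ≡ + (n C k)
  binomℤ-pos n       zero    = refl
  binomℤ-pos zero    (suc k) = trans (binomℤ-0ˡ k) (cong +_ (sym (k>n⇒nCk≡0 {0} {suc k} (s≤s z≤n))))
  binomℤ-pos (suc n) (suc k) = begin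
    binomℤ (+ suc n) (suc k)                ≡⟨ cong (λ m → binomℤ (+ m) (suc k)) (ℕ.+-comm n 1) ⟨
    binomℤ (+ n + + 1) (suc k)              ≡⟨ binomℤ-pascal (+ n) k ⟩
    binomℤ (+ n) (suc k) + binomℤ (+ n) k   ≡⟨ cong₂ _+_ (binomℤ-pos n (suc k)) (binomℤ-pos n k) ⟩
    + (n C suc k ℕ.+ n C k)                 ≡⟨ cong +_ (ℕ.+-comm (n C suc k) (n C k)) ⟩
    + (n C k ℕ.+ n C suc k)                 ≡⟨ cong +_ (nCk+nC[k+1]≡[n+1]C[k+1] n k) ⟩
    + (suc n C suc k)                       ∎
    where open ≡-Reasoning

  -- The F of the overview, translated to r = 0. The test copies the one in `summand`, so that both
  -- reduce alike.
  U : ℕ → ℕ → ℤ → ℤ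
  U q l x = if does (x - floorDiv x q * + q ℤ.≟ + 0) then binomℤ (floorDiv x q) l else + 0

  U-multiple : ∀ q .{{_ : NonZero q}} l k → U q l (k * + q) ≡ binomℤ k l
  U-multiple q l k rewrite floorDiv-* q k with k * + q - k * + q ℤ.≟ + 0
  ... | yes _ = refl
  ... | no ≢0 = ⊥-elim (≢0 (ℤ.+-inverseʳ (k * + q)))

  U-nonmultiple : ∀ q l {x} → ¬ (+ q ∣ x) → U q l x ≡ + 0
  U-nonmultiple q l {x} q∤x with x - floorDiv x q * + q ℤ.≟ + 0
  ... | yes ≡0 = ⊥-elim (q∤x (divides (floorDiv x q) (ℤ.i-j≡0⇒i≡j _ _ ≡0)))
  ... | no  _  = refl

  module _ (q : ℕ) .{{_ : NonZero q}} where

    q∣x+q⇒q∣x : ∀ {x} → + q ∣ x + + q → + q ∣ x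
    q∣x+q⇒q∣x d = ∣m+n∣n⇒∣m d (divides (+ 1) (sym (ℤ.*-identityˡ (+ q))))

    U-shift-0 : ∀ x → U q 0 (x + + q) ≡ U q 0 x
    U-shift-0 x with + q ∣? x
    ... | no q∤x =
      trans (U-nonmultiple q 0 (q∤x ∘ q∣x+q⇒q∣x)) (sym (U-nonmultiple q 0 q∤x))
    ... | yes (divides k refl) =
      trans (cong (U q 0) (sym (lem k (+ q)))) (trans (U-multiple q 0 (k + + 1)) (sym (U-multiple q 0 k)))
      where
      lem : ∀ k q → (k + + 1) * q ≡ k * q + q
      lem = ℤ-Ring.solve-∀

    -- Pascal's rule at x/q. In operator terms X^q - 1 lowers l by one, while by `U-shift-0` it
    -- annihilates level 0.
    U-shift-suc : ∀ l x → U q (suc l) (x + + q) ≡ U q (suc l) x + U q l x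
    U-shift-suc l x with + q ∣? x
    ... | no q∤x
      rewrite U-nonmultiple q (suc l) (q∤x ∘ q∣x+q⇒q∣x {x})
            | U-nonmultiple q (suc l) q∤x | U-nonmultiple q l q∤x = refl
    ... | yes (divides k refl) = begin
      U q (suc l) (k * + q + + q)            ≡⟨ cong (U q (suc l)) (lem k (+ q)) ⟨
      U q (suc l) ((k + + 1) * + q)          ≡⟨ U-multiple q (suc l) (k + + 1) ⟩
      binomℤ (k + + 1) (suc l)               ≡⟨ binomℤ-pascal k l ⟩
      binomℤ k (suc l) + binomℤ k l          ≡⟨ cong₂ _+_ (U-multiple q (suc l) k) (U-multiple q l k) ⟨
      U q (suc l) (k * + q) + U q l (k * + q) ∎
      where
      open ≡-Reasoning
      lem : ∀ k q → (k + + 1) * q ≡ k * q + q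
      lem = ℤ-Ring.solve-∀

  -- With c = p this is (p j - p r)/p^{a+1} = (j - r)/p^a, the effect of substituting k = p j on the
  -- weight.
  U-rescale : ∀ c q .{{_ : NonZero c}} .{{_ : NonZero q}} l x → U (c ℕ.* q) l (+ c * x) ≡ U q l x
  U-rescale c q l x with + q ∣? x
  ... | no q∤x = trans (U-nonmultiple (c ℕ.* q) l (q∤x ∘ cancel)) (sym (U-nonmultiple q l q∤x))
    where
    cancel : + (c ℕ.* q) ∣ + c * x → + q ∣ x
    cancel d = *-cancelˡ-∣ (+ c) (subst (_∣ + c * x) (ℤ.pos-* c q) d)
  ... | yes (divides k refl) = begin
    U (c ℕ.* q) l (+ c * (k * + q))   ≡⟨ cong (U (c ℕ.* q) l) (lem (+ c) k (+ q)) ⟩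
    U (c ℕ.* q) l (k * (+ c * + q))   ≡⟨ cong (λ u → U (c ℕ.* q) l (k * u)) (ℤ.pos-* c q) ⟨
    U (c ℕ.* q) l (k * + (c ℕ.* q))   ≡⟨ U-multiple (c ℕ.* q) {{ℕ.m*n≢0 c q}} l k ⟩
    binomℤ k l                        ≡⟨ U-multiple q l k ⟨
    U q l (k * + q)                   ∎
    where
    open ≡-Reasoning
    lem : ∀ c k q → c * (k * q) ≡ k * (c * q)
    lem = ℤ-Ring.solve-∀

  -- The induction applied to iterated differences of `U`.

  module _ {p : ℕ} (pr : Prime (suc p)) (b : ℕ) where

    private
      q : ℕ
      q = suc p ℕ.^ suc b
      instance
        q≢0 : NonZero q
        q≢0 = ℕ.m^n≢0 (suc p) (suc b)

    record Div (t : ℕ) (f : ShiftPoly) (l : ℕ) : Set where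
      constructor Div-intro
      field at : ∀ s → + (suc p ℕ.^ t) ∣ act f (U q l) s
    open Div

    private
      -- (1 + Δ)^q = X^q. The identity stays additive, and the common term is cancelled once F is
      -- some `U q l`.
      act-iterate-Ψ : ∀ F s → F (s + + q) ≡ F s + act (iterate-Ψ (suc p) Δ (suc b)) F s
      act-iterate-Ψ F s = begin
        F (s + + q)                  ≡⟨ act-X^ q F s ⟨
        act (X ^ˢ q) F s             ≡⟨ same (^-congˡ q 1+Δ≋X) F s ⟨
        act ((S.1# ⊕ Δ) ^ˢ q) F s    ≡⟨ same (1+iterate-Ψ (suc p) Δ (suc b)) F s ⟨
        + 1 * F s + act (iterate-Ψ (suc p) Δ (suc b)) F s
          ≡⟨ cong (_+ act (iterate-Ψ (suc p) Δ (suc b)) F s) (ℤ.*-identityˡ (F s)) ⟩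
        F s + act (iterate-Ψ (suc p) Δ (suc b)) F s ∎
        where open ≡-Reasoning

      act-iterate-Ψ-0 : ∀ s → act (iterate-Ψ (suc p) Δ (suc b)) (U q 0) s ≡ + 0
      act-iterate-Ψ-0 s = ℤ+-cancelˡ (U q 0 s) _ _
        (trans (sym (act-iterate-Ψ (U q 0) s)) (trans (U-shift-0 q s) (sym (ℤ.+-identityʳ (U q 0 s)))))

      act-iterate-Ψ-suc : ∀ l s → act (iterate-Ψ (suc p) Δ (suc b)) (U q (suc l)) s ≡ U q l s
      act-iterate-Ψ-suc l s = ℤ+-cancelˡ (U q (suc l) s) _ _
        (trans (sym (act-iterate-Ψ (U q (suc l)) s)) (U-shift-suc q l s))

      Div-≋ : ∀ {t f g l} → f ≋ g → Div t g l → Div t f l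
      Div-≋ {t} {l = l} f≋g d = Div-intro λ s →
        subst (+ (suc p ℕ.^ t) ∣_) (sym (same f≋g (U q l) s)) (at d s)

      Div-zero : ∀ {f l} → Div 0 f l
      Div-zero {f} {l} = Div-intro λ s → divides (act f (U q l) s) (sym (ℤ.*-identityʳ (act f (U q l) s)))

      Div-⊗ : ∀ {t f l} g → Div t f l → Div t (g ⊗ f) l
      Div-⊗ g d = Div-intro (act-∣ g (at d))

      Div-⊕ : ∀ {t f g l} → Div t f l → Div t g l → Div t (f ⊕ g) l
      Div-⊕ d e = Div-intro λ s → ∣m∣n⇒∣m+n (at d s) (at e s)

      Div-cancel : ∀ {t f g h l} → f ≋ (g ⊕ h) → Div t f l → Div t h l → Div t g l
      Div-cancel {t} {l = l} f≋ d e = Div-intro λ s →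
        ∣m+n∣n⇒∣m (subst (+ (suc p ℕ.^ t) ∣_) (same f≋ (U q l) s) (at d s)) (at e s)

      Div-p : ∀ {t f l} → Div t f l → Div (suc t) ((suc p · S.1#) ⊗ f) l
      Div-p {t} {f} {l} d = Div-intro λ s →
        subst (_∣ act ((suc p · S.1#) ⊗ f) (U q l) s) (sym (ℤ.pos-* (suc p) (suc p ℕ.^ t)))
          (subst (+ suc p * + (suc p ℕ.^ t) ∣_) (sym (act-·1 (suc p) (act f (U q l)) s))
            (*-monoʳ-∣ (+ suc p) (at d s)))

      Div-y-0 : ∀ {t} f → Div t (f ⊗ iterate-Ψ (suc p) Δ (suc b)) 0
      Div-y-0 f = Div-intro (act-∣ f (λ s → divides (+ 0) (act-iterate-Ψ-0 s)))

      Div-y-suc : ∀ {t l} f → Div t f l → Div t (f ⊗ iterate-Ψ (suc p) Δ (suc b)) (suc l)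
      Div-y-suc {t} {l} f d = Div-intro λ s →
        subst (+ (suc p ℕ.^ t) ∣_) (sym (act-cong f (act-iterate-Ψ-suc l) s)) (at d s)

    Δ^-div : ∀ l t n → suc p ℕ.^ b ℕ.* p ℕ.* t ℕ.+ suc p ℕ.^ b ℕ.+ l ℕ.* q ℕ.≤ n →
             ∀ s → + (suc p ℕ.^ t) ∣ act (Δ ^ˢ n) (U q l) s
    Δ^-div l t n ≤n = subst (λ m → ∀ s → + (suc p ℕ.^ t) ∣ act (Δ ^ˢ m) (U q l) s)
      (proj₂ (ℕ.m≤n⇒∃[o]m+o≡n ≤n))
      (at (WeismanWan.z^-div shiftPolySemiring pr b Δ Div Div-≋ Div-zero Div-⊗ Div-⊕ Div-cancel
             Div-p Div-y-0 Div-y-suc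
             {P = suc p ℕ.^ b} {e = suc p ℕ.^ b ℕ.* p}
             (lem (suc p ℕ.^ b) p) (proj₂ (Φ-mod pr Δ b)) (proj₂ (iterate-Ψ-mod pr Δ b))
             (proj₂ (Ψ-constant (suc p) (iterate-Ψ (suc p) Δ b)))
             l t (proj₁ (ℕ.m≤n⇒∃[o]m+o≡n ≤n))))
      where
      lem : ∀ P p → suc p ℕ.* P ≡ P ℕ.+ P ℕ.* p
      lem = ℕ-Ring.solve-∀

  -- The case q = 1, where U 1 l is x ↦ binom(x, l) and (1 + Δ)^1 − 1 = Δ.
  Δ-U₁-suc : ∀ l s → act Δ (U 1 (suc l)) s ≡ U 1 l s
  Δ-U₁-suc l s = trans (cong (_+ ℤ.-1ℤ * U 1 (suc l) s) (U-shift-suc 1 l s)) (lem (U 1 (suc l) s) (U 1 l s))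
    where
    lem : ∀ a b → a + b + ℤ.-1ℤ * a ≡ b
    lem = ℤ-Ring.solve-∀

  Δ-U₁-0 : ∀ s → act Δ (U 1 0) s ≡ + 0
  Δ-U₁-0 s = trans (cong (_+ ℤ.-1ℤ * U 1 0 s) (U-shift-0 1 s)) (lem (U 1 0 s))
    where
    lem : ∀ a → a + ℤ.-1ℤ * a ≡ + 0
    lem = ℤ-Ring.solve-∀

  -- Being divisible by 0 means being 0, so `act-∣` with d = 0 gives this without an induction on f.
  act-0 : ∀ f s → act f (λ _ → + 0) s ≡ + 0
  act-0 f s = 0∣⇒≡0 (act-∣ f (λ _ → divides (+ 0) refl) s)

  -- binom(x, l) is a polynomial of degree l: each Δ lowers l by one, and one more annihilates the
  -- constant.
  Δ^-U₁-vanish : ∀ l n → l ℕ.< n → ∀ s → act (Δ ^ˢ n) (U 1 l) s ≡ + 0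
  Δ^-U₁-vanish l       (suc n) l<n s with act-comm Δ (Δ ^ˢ n) (U 1 l) s
  Δ^-U₁-vanish zero    (suc n) l<n s | eq =
    trans eq (trans (act-cong (Δ ^ˢ n) Δ-U₁-0 s) (act-0 (Δ ^ˢ n) s))
  Δ^-U₁-vanish (suc l) (suc n) (s≤s l<n) s | eq =
    trans eq (trans (act-cong (Δ ^ˢ n) (Δ-U₁-suc l) s) (Δ^-U₁-vanish l n l<n s))

  -- Newton expansion of the bracket sums

  act-evl : ∀ N c z F s → act (evl N c z) F s ≡ ∑ N (λ k → + c k * act (z ^ˢ k) F s)
  act-evl zero    c z F s = refl
  act-evl (suc N) c z F s = cong₂ _+_
    (trans (act-·1 (c 0) F s) (cong (+ c 0 *_) (sym (ℤ.*-identityˡ (F s)))))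
    (trans (act-comm z (evl N (c ∘ suc) z) F s)
      (trans (act-evl N (c ∘ suc) z (act z F) s)
        (∑-cong N (λ k _ → cong (+ c (suc k) *_) (sym (act-comm z (z ^ˢ k) F s))))))

  newton : ∀ {j n} → j ℕ.≤ n → ∀ F s →
           F (s + + j) ≡ ∑ (suc n) (λ m → + (j C m) * act (Δ ^ˢ m) F s)
  newton {j} {n} j≤n F s = begin
    F (s + + j)                                      ≡⟨ act-X^ j F s ⟨
    act (X ^ˢ j) F s                                 ≡⟨ same (^-congˡ j 1+Δ≋X) F s ⟨
    act ((S.1# ⊕ Δ) ^ˢ j) F s                        ≡⟨ same (evl-binomial j Δ) F s ⟨
    act (evl (suc j) (j C_) Δ) F s                   ≡⟨ same (evl-extend Δ (s≤s j≤n) (λ k j<k → k>n⇒nCk≡0 j<k)) F s ⟨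
    act (evl (suc n) (j C_) Δ) F s                   ≡⟨ act-evl (suc n) (j C_) Δ F s ⟩
    ∑ (suc n) (λ m → + (j C m) * act (Δ ^ˢ m) F s)   ∎
    where open ≡-Reasoning

  -- The left side is (1 - X)^n F = (-Δ)^n F. The sign remains an operator, through which
  -- divisibility passes by `act-∣`.
  alternating-∑ : ∀ n F s →
    ∑ (suc n) (λ k → -1ℤ ℤ.^ k * + (n C k) * F (s + + k)) ≡ act (con -1ℤ ^ˢ n) (act (Δ ^ˢ n) F) s
  alternating-∑ n F s = begin
    ∑ (suc n) (λ k → -1ℤ ℤ.^ k * + (n C k) * F (s + + k))
      ≡⟨ ∑-cong (suc n) (λ k _ → trans (lem (-1ℤ ℤ.^ k) (+ (n C k)) (F (s + + k)))
           (cong (+ (n C k) *_) (sym (act-W^ k s)))) ⟩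
    ∑ (suc n) (λ k → + (n C k) * act (W ^ˢ k) F s)
      ≡⟨ act-evl (suc n) (n C_) W F s ⟨
    act (evl (suc n) (n C_) W) F s
      ≡⟨ same (evl-binomial n W) F s ⟩
    act ((S.1# ⊕ W) ^ˢ n) F s
      ≡⟨ same (^-congˡ n 1+W≋-Δ) F s ⟩
    act ((con -1ℤ ⊗ Δ) ^ˢ n) F s
      ≡⟨ same (^-distrib-* (con -1ℤ) Δ n) F s ⟩
    act (con -1ℤ ^ˢ n) (act (Δ ^ˢ n) F) s ∎
    where
    open ≡-Reasoning
    W : ShiftPoly
    W = X ⊗ con -1ℤ
    lem : ∀ a b c → a * b * c ≡ b * (a * c)
    lem = ℤ-Ring.solve-∀
    1+W≋-Δ : (S.1# ⊕ W) ≋ (con -1ℤ ⊗ Δ)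
    1+W≋-Δ = ≋-intro λ F s → eq (F s) (F (s + + 1))
      where
      eq : ∀ a b → + 1 * a + -1ℤ * b ≡ -1ℤ * (b + -1ℤ * a)
      eq = ℤ-Ring.solve-∀
    act-W^ : ∀ k s → act (W ^ˢ k) F s ≡ -1ℤ ℤ.^ k * F (s + + k)
    act-W^ zero    s = trans (ℤ.*-identityˡ (F s)) (trans (cong F (sym (ℤ.+-identityʳ s))) (sym (ℤ.*-identityˡ _)))
    act-W^ (suc k) s = trans (cong (-1ℤ *_) (trans (act-W^ k (s + + 1))
        (cong (λ x → -1ℤ ℤ.^ k * F x) (ℤ.+-assoc s (+ 1) (+ k)))))
      (sym (ℤ.*-assoc -1ℤ (-1ℤ ℤ.^ k) _))

  foldr-upTo : ∀ n (f : ℕ → ℤ) → foldr _+_ (+ 0) (map f (upTo n)) ≡ ∑ n f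
  foldr-upTo n f = trans (cong (foldr _+_ (+ 0)) (map-upTo f n)) (go n f)
    where
    go : ∀ n f → foldr _+_ (+ 0) (applyUpTo f n) ≡ ∑ n f
    go zero    f = refl
    go (suc n) f = cong (_+_ (f 0)) (go n (f ∘ suc))

  summand-U : ∀ p b l n r k → summand p b l n r k ≡ -1ℤ ℤ.^ k * + (n C k) * U (p ℕ.^ b) l (- r + + k)
  summand-U p b l n r k = trans (if-* _ (-1ℤ ℤ.^ k * + (n C k)) _)
    (cong (λ x → -1ℤ ℤ.^ k * + (n C k) * U (p ℕ.^ b) l x) (ℤ.+-comm (+ k) (- r)))
    where
    if-* : ∀ t a x → (if t then a * x else + 0) ≡ a * (if t then x else + 0)
    if-* true  a x = refl
    if-* false a x = sym (ℤ.*-zeroʳ a)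

  bracketSum-∑ : ∀ p b l n r →
    bracketSum p b l n r ≡ ∑ (suc n) (λ k → -1ℤ ℤ.^ k * + (n C k) * U (p ℕ.^ b) l (- r + + k))
  bracketSum-∑ p b l n r = trans (foldr-upTo (suc n) (summand p b l n r))
    (∑-cong (suc n) (λ k _ → summand-U p b l n r k))

  bracketSum-act : ∀ p b l n r →
    bracketSum p b l n r ≡ act (con -1ℤ ^ˢ n) (act (Δ ^ˢ n) (U (p ℕ.^ b) l)) (- r)
  bracketSum-act p b l n r = trans (bracketSum-∑ p b l n r) (alternating-∑ n (U (p ℕ.^ b) l) (- r))

  -- p^{b+1} divides k - p r only when p divides k; for k = p j, `U-rescale` removes one p from the
  -- modulus.
  bracketSum-rescale : ∀ p .{{_ : NonZero p}} b l n r →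
    bracketSum p (suc b) l (p ℕ.* n) (+ p * r) ≡
    ∑ (suc n) (λ j → -1ℤ ℤ.^ (p ℕ.* j) * + ((p ℕ.* n) C (p ℕ.* j)) * U (p ℕ.^ b) l (- r + + j))
  bracketSum-rescale p b l n r = begin
    bracketSum p (suc b) l (p ℕ.* n) (+ p * r)
      ≡⟨ bracketSum-∑ p (suc b) l (p ℕ.* n) (+ p * r) ⟩
    ∑ (suc (p ℕ.* n)) (λ k → -1ℤ ℤ.^ k * + ((p ℕ.* n) C k) * U (p ℕ.^ suc b) l (- (+ p * r) + + k))
      ≡⟨ ∑-multiples p n _ (λ k p∤k → trans
           (cong (-1ℤ ℤ.^ k * + ((p ℕ.* n) C k) *_) (U-nonmultiple (p ℕ.^ suc b) l (p∤k ∘ ∣-from k)))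
           (ℤ.*-zeroʳ (-1ℤ ℤ.^ k * + ((p ℕ.* n) C k)))) ⟩
    ∑ (suc n) (λ j → -1ℤ ℤ.^ (p ℕ.* j) * + ((p ℕ.* n) C (p ℕ.* j)) * U (p ℕ.^ suc b) l (- (+ p * r) + + (p ℕ.* j)))
      ≡⟨ ∑-cong (suc n) (λ j _ → cong (-1ℤ ℤ.^ (p ℕ.* j) * + ((p ℕ.* n) C (p ℕ.* j)) *_)
           (trans (cong (U (p ℕ.^ suc b) l) (factor j)) (U-rescale p (p ℕ.^ b) {{it}} {{ℕ.m^n≢0 p b}} l (- r + + j)))) ⟩
    ∑ (suc n) (λ j → -1ℤ ℤ.^ (p ℕ.* j) * + ((p ℕ.* n) C (p ℕ.* j)) * U (p ℕ.^ b) l (- r + + j)) ∎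
    where
    open ≡-Reasoning
    factor : ∀ j → - (+ p * r) + + (p ℕ.* j) ≡ + p * (- r + + j)
    factor j = trans (cong (_+_ (- (+ p * r))) (ℤ.pos-* p j)) (lem (+ p) r (+ j))
      where
      lem : ∀ p r j → - (p * r) + p * j ≡ p * (- r + j)
      lem = ℤ-Ring.solve-∀
    ∣-from : ∀ k → + (p ℕ.^ suc b) ∣ - (+ p * r) + + k → p ℕ∣.∣ k
    ∣-from k d = ∣⇒∣ᵤ (∣m+n∣m⇒∣n (∣-trans (divides (+ (p ℕ.^ b)) (trans (ℤ.pos-* p (p ℕ.^ b)) (ℤ.*-comm (+ p) (+ (p ℕ.^ b))))) d)
                   (∣m⇒∣-m (∣m⇒∣m*n r (∣-refl {+ p}))))

  newton-∑ : ∀ n (c : ℕ → ℤ) (F : ℤ → ℤ) s →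
    ∑ (suc n) (λ j → c j * F (s + + j)) ≡
    ∑ (suc n) (λ m → ∑ (suc n) (λ j → c j * + (j C m)) * act (Δ ^ˢ m) F s)
  newton-∑ n c F s = begin
    ∑ (suc n) (λ j → c j * F (s + + j))
      ≡⟨ ∑-cong (suc n) (λ j j≤n → trans
           (cong (c j *_) (newton (ℕ.≤-pred j≤n) F s))
           (sym (∑-*ˡ (suc n) (c j) (λ m → + (j C m) * v m)))) ⟩
    ∑ (suc n) (λ j → ∑ (suc n) (λ m → c j * (+ (j C m) * v m)))
      ≡⟨ ∑-swap (suc n) (suc n) (λ j m → c j * (+ (j C m) * v m)) ⟩
    ∑ (suc n) (λ m → ∑ (suc n) (λ j → c j * (+ (j C m) * v m)))
      ≡⟨ ∑-cong (suc n) (λ m _ → trans (∑-cong (suc n) (λ j _ → lem (c j) (+ (j C m)) (v m)))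
           (trans (∑-*ˡ (suc n) (v m) (λ j → c j * + (j C m))) (ℤ.*-comm (v m) (∑ (suc n) (λ j → c j * + (j C m)))))) ⟩
    ∑ (suc n) (λ m → ∑ (suc n) (λ j → c j * + (j C m)) * v m) ∎
    where
    open ≡-Reasoning
    v : ℕ → ℤ
    v m = act (Δ ^ˢ m) F s
    lem : ∀ a b c → a * (b * c) ≡ c * (a * b)
    lem = ℤ-Ring.solve-∀

  module _ (p : ℕ) .{{_ : NonZero p}} (n : ℕ) where

    newton-coeff : ℕ → ℤ
    newton-coeff m = ∑ (suc n) (λ j → coeff-diff p n j * + (j C m))

    bracketSum-diff : ∀ b l r →
      bracketSum p (suc b) l (p ℕ.* n) (+ p * r) - bracketSum p b l n r ≡
      ∑ (suc n) (λ j → coeff-diff p n j * U (p ℕ.^ b) l (- r + + j))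
    bracketSum-diff b l r = trans
      (cong₂ _-_ (bracketSum-rescale p b l n r) (bracketSum-∑ p b l n r))
      (trans (sym (∑-- (suc n)
          (λ j → -1ℤ ℤ.^ (p ℕ.* j) * + ((p ℕ.* n) C (p ℕ.* j)) * U (p ℕ.^ b) l (- r + + j))
          (λ j → -1ℤ ℤ.^ j * + (n C j) * U (p ℕ.^ b) l (- r + + j))))
        (∑-cong (suc n) (λ j _ → lem (-1ℤ ℤ.^ (p ℕ.* j) * + ((p ℕ.* n) C (p ℕ.* j))) (-1ℤ ℤ.^ j * + (n C j))
          (U (p ℕ.^ b) l (- r + + j)))))
      where
      lem : ∀ a b u → a * u - b * u ≡ (a - b) * u
      lem = ℤ-Ring.solve-∀

    bracketSum-diff-newton : ∀ b l r →
      bracketSum p (suc b) l (p ℕ.* n) (+ p * r) - bracketSum p b l n r ≡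
      ∑ (suc n) (λ m → newton-coeff m * act (Δ ^ˢ m) (U (p ℕ.^ b) l) (- r))
    bracketSum-diff-newton b l r =
      trans (bracketSum-diff b l r) (newton-∑ n (coeff-diff p n) (U (p ℕ.^ b) l) (- r))

    -- C(j, m) is the weight for modulus p^0, r = 0 and l = m, so `bracketSum-diff` applies to the
    -- coefficient itself. The subtracted sum of modulus 1 is, up to sign, an n-th difference of a
    -- polynomial of degree m < n.
    newton-coeff-bracketSum : ∀ {m} → m ℕ.< n →
      newton-coeff m ≡ bracketSum p 1 m (p ℕ.* n) (+ 0)
    newton-coeff-bracketSum {m} m<n = begin
      newton-coeff m
        ≡⟨ ∑-cong (suc n) (λ j _ → cong (coeff-diff p n j *_) (sym (U₁ j))) ⟩
      ∑ (suc n) (λ j → coeff-diff p n j * U 1 m (- + 0 + + j))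
        ≡⟨ bracketSum-diff 0 m (+ 0) ⟨
      bracketSum p 1 m (p ℕ.* n) (+ p * + 0) - bracketSum p 0 m n (+ 0)
        ≡⟨ cong₂ _-_ (cong (bracketSum p 1 m (p ℕ.* n)) (ℤ.*-zeroʳ (+ p))) vanish ⟩
      bracketSum p 1 m (p ℕ.* n) (+ 0) - + 0
        ≡⟨ ℤ.+-identityʳ _ ⟩
      bracketSum p 1 m (p ℕ.* n) (+ 0) ∎
      where
      open ≡-Reasoning
      U₁ : ∀ j → U 1 m (- + 0 + + j) ≡ + (j C m)
      U₁ j = trans (cong (U 1 m) (trans (ℤ.+-identityˡ (+ j)) (sym (ℤ.*-identityʳ (+ j)))))
               (trans (U-multiple 1 m (+ j)) (binomℤ-pos j m))
      vanish : bracketSum p 0 m n (+ 0) ≡ + 0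
      vanish = trans (bracketSum-act p 0 m n (+ 0))
        (trans (act-cong (con -1ℤ ^ˢ n) (Δ^-U₁-vanish m n m<n) (+ 0)) (act-0 (con -1ℤ ^ˢ n) (+ 0)))

  -- The exponents of the brackets

  prime-∤⇒coprime-^ : ∀ {q} → Prime q → ∀ {a} → ¬ (q ℕ∣.∣ a) → ∀ b → Coprime a (q ℕ.^ b)
  prime-∤⇒coprime-^ {q} pr {a} q∤a b {d} (d∣a , d∣q^b) = ℕ∣.∣1⇒≡1 (strip b d∣q^b)
    where
    d⊥q : Coprime d q
    d⊥q (e∣d , e∣q) with prime⇒irreducible pr e∣q
    ... | inj₁ e≡1  = e≡1
    ... | inj₂ refl = ⊥-elim (q∤a (ℕ∣.∣-trans e∣d d∣a))
    strip : ∀ b → d ℕ∣.∣ q ℕ.^ b → d ℕ∣.∣ 1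
    strip zero    d∣ = d∣
    strip (suc b) d∣ = strip b (coprime-divisor d⊥q d∣)

  count : ℕ → (ℕ → Bool) → ℕ
  count zero    t = 0
  count (suc n) t = if t 0 then suc (count n (t ∘ suc)) else count n (t ∘ suc)

  length-filter-applyUpTo : ∀ {P : ℕ → Set} (P? : Decidable P) n f →
    length (filter P? (applyUpTo f n)) ≡ count n (λ k → does (P? (f k)))
  length-filter-applyUpTo P? zero    f = refl
  length-filter-applyUpTo P? (suc n) f with does (P? (f 0))
  ... | true  = cong suc (length-filter-applyUpTo P? n (f ∘ suc))
  ... | false = length-filter-applyUpTo P? n (f ∘ suc)

  count-split : ∀ m n t → count (m ℕ.+ n) t ≡ count m t ℕ.+ count n (λ k → t (m ℕ.+ k))
  count-split zero    n t = refl
  count-split (suc m) n t with t 0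
  ... | true  = cong suc (count-split m n (t ∘ suc))
  ... | false = count-split m n (t ∘ suc)

  count-all : ∀ n {t} → (∀ k → k ℕ.< n → t k ≡ true) → count n t ≡ n
  count-all zero    t≡ = refl
  count-all (suc n) t≡ rewrite t≡ 0 (s≤s z≤n) = cong suc (count-all n (λ k k<n → t≡ (suc k) (s≤s k<n)))

  -- The test at k concerns k + 1, as in `totient`, so each block of `suc p` positions has p
  -- accepted ones followed by one rejected.
  count-nonmultiples : ∀ p n (t : ℕ → Bool) →
    (∀ k → ¬ (suc p ℕ∣.∣ suc k) → t k ≡ true) → (∀ k → suc p ℕ∣.∣ suc k → t k ≡ false) →
    count (n ℕ.* suc p) t ≡ n ℕ.* p
  count-nonmultiples p zero    t t-true t-false = refl
  count-nonmultiples p (suc n) t t-true t-false = begin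
    count (suc p ℕ.+ n ℕ.* suc p) t
      ≡⟨ cong (λ m → count (m ℕ.+ n ℕ.* suc p) t) (ℕ.+-comm 1 p) ⟩
    count (p ℕ.+ 1 ℕ.+ n ℕ.* suc p) t
      ≡⟨ count-split (p ℕ.+ 1) (n ℕ.* suc p) t ⟩
    count (p ℕ.+ 1) t ℕ.+ count (n ℕ.* suc p) (λ k → t (p ℕ.+ 1 ℕ.+ k))
      ≡⟨ cong₂ ℕ._+_ block (count-nonmultiples p n (λ k → t (p ℕ.+ 1 ℕ.+ k))
           (λ k ∤k → t-true (p ℕ.+ 1 ℕ.+ k) (λ d → ∤k (ℕ∣.∣m+n∣m⇒∣n (subst (suc p ℕ∣.∣_) (shift k) d) ℕ∣.∣-refl)))
           (λ k ∣k → t-false (p ℕ.+ 1 ℕ.+ k) (subst (suc p ℕ∣.∣_) (sym (shift k)) (ℕ∣.∣m∣n⇒∣m+n ℕ∣.∣-refl ∣k)))) ⟩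
    p ℕ.+ n ℕ.* p ∎
    where
    open ≡-Reasoning
    shift : ∀ k → suc (p ℕ.+ 1 ℕ.+ k) ≡ suc p ℕ.+ suc k
    shift k = lem p k
      where
      lem : ∀ p k → suc (p ℕ.+ 1 ℕ.+ k) ≡ suc p ℕ.+ suc k
      lem = ℕ-Ring.solve-∀
    block : count (p ℕ.+ 1) t ≡ p
    block rewrite count-split p 1 t
                | t-false (p ℕ.+ 0) (ℕ∣.∣-reflexive (cong suc (sym (ℕ.+-identityʳ p))))
                | ℕ.+-identityʳ (count p t)
          = count-all p (λ k k<p → t-true k (λ d → ℕ.<⇒≱ (s≤s k<p) (ℕ∣.∣⇒≤ d)))

  totient-prime-power : ∀ {p} → Prime (suc p) → ∀ b → totient (suc p ℕ.^ suc b) ≡ suc p ℕ.^ b ℕ.* p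
  totient-prime-power {p} pr b = begin
    totient (suc p ℕ.^ suc b)
      ≡⟨ length-filter-applyUpTo (λ k → gcd (suc k) (suc p ℕ.^ suc b) ℕ.≟ 1) (suc p ℕ.^ suc b) (λ k → k) ⟩
    count (suc p ℕ.^ suc b) t
      ≡⟨ cong (λ m → count m t) (ℕ.*-comm (suc p) (suc p ℕ.^ b)) ⟩
    count (suc p ℕ.^ b ℕ.* suc p) t
      ≡⟨ count-nonmultiples p (suc p ℕ.^ b) t
           (λ k ∤k → dec-true (gcd (suc k) (suc p ℕ.^ suc b) ℕ.≟ 1) (coprime⇒gcd≡1 (prime-∤⇒coprime-^ pr ∤k (suc b))))
           (λ k ∣k → dec-false (gcd (suc k) (suc p ℕ.^ suc b) ℕ.≟ 1) (λ gcd≡1 →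
             ¬prime[1] (subst Prime (ℕ∣.∣1⇒≡1 (subst (suc p ℕ∣.∣_) gcd≡1 (gcd-greatest ∣k (ℕ∣.m∣m*n (suc p ℕ.^ b))))) pr))) ⟩
    suc p ℕ.^ b ℕ.* p ∎
    where
    open ≡-Reasoning
    t : ℕ → Bool
    t k = does (gcd (suc k) (suc p ℕ.^ suc b) ℕ.≟ 1)

  floorDiv-scale : ∀ c d .{{_ : NonZero c}} .{{_ : NonZero d}} x →
                   floorDiv (+ c * x) (c ℕ.* d) ≡ floorDiv x d
  floorDiv-scale c d@(suc _) x = floorDiv-unique (c ℕ.* d) {{ℕ.m*n≢0 c d}} (x /ℕ d) (c ℕ.* (x %ℕ d))
    (ℕ.*-monoʳ-< c (n%ℕd<d x d)) (begin
      + c * x                                        ≡⟨ cong (+ c *_) (a≡a%ℕn+[a/ℕn]*n x d) ⟩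
      + c * (+ (x %ℕ d) + (x /ℕ d) * + d)            ≡⟨ lem (+ c) (+ (x %ℕ d)) (x /ℕ d) (+ d) ⟩
      + c * + (x %ℕ d) + (x /ℕ d) * (+ c * + d)      ≡⟨ cong₂ (λ a b → a + (x /ℕ d) * b) (ℤ.pos-* c (x %ℕ d)) (ℤ.pos-* c d) ⟨
      + (c ℕ.* (x %ℕ d)) + (x /ℕ d) * + (c ℕ.* d)    ∎)
    where
    open ≡-Reasoning
    lem : ∀ c r q d → c * (r + q * d) ≡ c * r + q * (c * d)
    lem = ℤ-Ring.solve-∀

  floorDiv-*≤ : ∀ d .{{_ : NonZero d}} x → floorDiv x d * + d ℤ.≤ x
  floorDiv-*≤ d@(suc _) x = [n/ℕd]*d≤n x d

  -- The rounded-up quotient of d by p, used with p the prime minus one. The lower bound limits the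
  -- loss in the differences of `U` to g; the upper bound lets the Newton coefficients make it up.
  ceiling : ∀ p .{{_ : NonZero p}} d → ∃ λ g → d ℕ.≤ p ℕ.* g × p ℕ.* g ℕ.< d ℕ.+ p
  ceiling (suc p) d = (d ℕ.+ p) ℕ./ suc p ,
    ℕ.+-cancelˡ-≤ p _ _ (begin
      p ℕ.+ d                                     ≡⟨ ℕ.+-comm p d ⟩
      d ℕ.+ p                                     ≡⟨ div ⟩
      (d ℕ.+ p) ℕ.% suc p ℕ.+ suc p ℕ.* g         ≤⟨ ℕ.+-monoˡ-≤ (suc p ℕ.* g) (ℕ.≤-pred (m%n<n (d ℕ.+ p) (suc p))) ⟩
      p ℕ.+ suc p ℕ.* g                           ∎) ,
    (begin-strict
      suc p ℕ.* g                                 ≤⟨ ℕ.m≤n+m (suc p ℕ.* g) ((d ℕ.+ p) ℕ.% suc p) ⟩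
      (d ℕ.+ p) ℕ.% suc p ℕ.+ suc p ℕ.* g         ≡⟨ div ⟨
      d ℕ.+ p                                     <⟨ ℕ.+-monoʳ-< d (ℕ.n<1+n p) ⟩
      d ℕ.+ suc p                                 ∎)
    where
    open ℕ.≤-Reasoning
    g : ℕ
    g = (d ℕ.+ p) ℕ./ suc p
    div : d ℕ.+ p ≡ (d ℕ.+ p) ℕ.% suc p ℕ.+ suc p ℕ.* g
    div = trans (m≡m%n+[m/n]*n (d ℕ.+ p) (suc p)) (cong (ℕ._+_ ((d ℕ.+ p) ℕ.% suc p)) (ℕ.*-comm g (suc p)))

  ^-∣-mono : ∀ q {s t} → s ℕ.≤ t → + (q ℕ.^ s) ∣ + (q ℕ.^ t)
  ^-∣-mono q {s} s≤t with ℕ.m≤n⇒∃[o]m+o≡n s≤t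
  ... | o , refl = divides (+ (q ℕ.^ o)) (trans (+-pow-+ q s o) (ℤ.*-comm (+ (q ℕ.^ s)) (+ (q ℕ.^ o))))

  -- Divisibility of Newton coefficients and of differences of bracket sums.

  module _ {p : ℕ} .{{_ : NonZero p}} (pr : Prime (suc p)) where

    private
      q : ℕ
      q = suc p

    bracketSum-div : ∀ b l t n r → q ℕ.^ b ℕ.* p ℕ.* t ℕ.+ q ℕ.^ b ℕ.+ l ℕ.* q ℕ.^ suc b ℕ.≤ n →
                     + (q ℕ.^ t) ∣ bracketSum q (suc b) l n r
    bracketSum-div b l t n r ≤n = subst (+ (q ℕ.^ t) ∣_) (sym (bracketSum-act q (suc b) l n r))
      (act-∣ (con -1ℤ ^ˢ n) (Δ^-div pr b l t n ≤n) (- r))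

    module _ (n w v : ℕ) .{{_ : NonZero n}} (q^w∣n : + (q ℕ.^ w) ∣ + n)
             (v< : q ℕ.* v ℕ.< p ℕ.* (2 ℕ.* w ℕ.+ δ q)) where

      private
        K : ℕ
        K = 2 ℕ.* w ℕ.+ δ q

      newton-coeff-div : ∀ m d g → m ℕ.+ d ≡ n → p ℕ.* g ℕ.< d ℕ.+ p →
                         + (q ℕ.^ (suc v ℕ.+ g)) ∣ newton-coeff q n m
      newton-coeff-div m d g m+d g< with suc (suc v) ℕ.≤? d
      -- Here (1) at modulus q and upper index q n suffices: p (v+1+g) + 1 ≤ p (v+2) + d ≤ q d.
      ... | yes v+2≤d = subst (+ (q ℕ.^ (suc v ℕ.+ g)) ∣_)
        (sym (newton-coeff-bracketSum q n m<n))
        (bracketSum-div 0 m (suc v ℕ.+ g) (q ℕ.* n) (+ 0) (begin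
          q ℕ.^ 0 ℕ.* p ℕ.* (suc v ℕ.+ g) ℕ.+ q ℕ.^ 0 ℕ.+ m ℕ.* q ℕ.^ 1
            ≡⟨ lem₁ p v g m ⟩
          p ℕ.* suc v ℕ.+ suc (p ℕ.* g) ℕ.+ q ℕ.* m
            ≤⟨ ℕ.+-monoˡ-≤ (q ℕ.* m) (ℕ.+-monoʳ-≤ (p ℕ.* suc v) g<) ⟩
          p ℕ.* suc v ℕ.+ (d ℕ.+ p) ℕ.+ q ℕ.* m
            ≡⟨ lem₂ p v d m ⟩
          p ℕ.* suc (suc v) ℕ.+ d ℕ.+ q ℕ.* m
            ≤⟨ ℕ.+-monoˡ-≤ (q ℕ.* m) (ℕ.+-monoˡ-≤ d (ℕ.*-monoʳ-≤ p v+2≤d)) ⟩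
          p ℕ.* d ℕ.+ d ℕ.+ q ℕ.* m
            ≡⟨ lem₃ p d m ⟩
          q ℕ.* (m ℕ.+ d)
            ≡⟨ cong (q ℕ.*_) m+d ⟩
          q ℕ.* n ∎))
        where
        open ℕ.≤-Reasoning
        m<n : m ℕ.< n
        m<n = subst (m ℕ.<_) m+d (ℕ.m<m+n m (ℕ.≤-trans (s≤s z≤n) v+2≤d))
        lem₁ : ∀ p v g m → 1 ℕ.* p ℕ.* (suc v ℕ.+ g) ℕ.+ 1 ℕ.+ m ℕ.* (suc p ℕ.* 1)
             ≡ p ℕ.* suc v ℕ.+ suc (p ℕ.* g) ℕ.+ suc p ℕ.* m
        lem₁ = ℕ-Ring.solve-∀
        lem₂ : ∀ p v d m → p ℕ.* suc v ℕ.+ (d ℕ.+ p) ℕ.+ suc p ℕ.* m ≡ p ℕ.* suc (suc v) ℕ.+ d ℕ.+ suc p ℕ.* m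
        lem₂ = ℕ-Ring.solve-∀
        lem₃ : ∀ p d m → p ℕ.* d ℕ.+ d ℕ.+ suc p ℕ.* m ≡ suc p ℕ.* (m ℕ.+ d)
        lem₃ = ℕ-Ring.solve-∀
      ... | no v+2≰d = ∣-trans (^-∣-mono q v+1+g≤K+1)
        (∑-∣ (suc n) {λ j → coeff-diff q n j * + (j C m)} (λ j j≤n → ∣m⇒∣m*n (+ (j C m)) (PrimeBlocks.coeff-diff-∣ pr w n q^w∣n j (ℕ.≤-pred j≤n))))
        where
        open ℕ.≤-Reasoning
        lem₁ : ∀ p v g → p ℕ.* (v ℕ.+ g) ≡ p ℕ.* v ℕ.+ p ℕ.* g
        lem₁ = ℕ-Ring.solve-∀
        lem₂ : ∀ p v → p ℕ.* v ℕ.+ (suc v ℕ.+ p) ≡ suc (suc p ℕ.* v) ℕ.+ p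
        lem₂ = ℕ-Ring.solve-∀
        v+g<K+1 : v ℕ.+ g ℕ.< suc K
        v+g<K+1 = ℕ.*-cancelˡ-< p (v ℕ.+ g) (suc K) (begin-strict
          p ℕ.* (v ℕ.+ g)                   ≡⟨ lem₁ p v g ⟩
          p ℕ.* v ℕ.+ p ℕ.* g               <⟨ ℕ.+-monoʳ-< (p ℕ.* v) g< ⟩
          p ℕ.* v ℕ.+ (d ℕ.+ p)             ≤⟨ ℕ.+-monoʳ-≤ (p ℕ.* v) (ℕ.+-monoˡ-≤ p (ℕ.≤-pred (ℕ.≰⇒> v+2≰d))) ⟩
          p ℕ.* v ℕ.+ (suc v ℕ.+ p)         ≡⟨ lem₂ p v ⟩
          suc (q ℕ.* v) ℕ.+ p               ≤⟨ ℕ.+-monoˡ-≤ p v< ⟩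
          p ℕ.* K ℕ.+ p                     ≡⟨ trans (ℕ.+-comm (p ℕ.* K) p) (sym (ℕ.*-suc p K)) ⟩
          p ℕ.* suc K                       ∎)
        v+1+g≤K+1 : suc v ℕ.+ g ℕ.≤ suc K
        v+1+g≤K+1 = v+g<K+1

      -- T is the exponent in the brackets. The alternative T = 0 serves negative exponents, for
      -- which n satisfies no size condition.
      bracketSum-diff-div : ∀ b l r T →
        T ≡ 0 ⊎ q ℕ.^ b ℕ.* p ℕ.* T ℕ.+ q ℕ.^ b ℕ.+ l ℕ.* q ℕ.^ suc b ℕ.≤ n →
        + (q ℕ.^ (suc v ℕ.+ T)) ∣ bracketSum q (suc (suc b)) l (q ℕ.* n) (+ q * r) - bracketSum q (suc b) l n r
      bracketSum-diff-div b l r T T-bound =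
        subst (+ (q ℕ.^ (suc v ℕ.+ T)) ∣_) (sym (bracketSum-diff-newton q n (suc b) l r))
          (∑-∣ (suc n) {λ m → newton-coeff q n m * act (Δ ^ˢ m) (U (q ℕ.^ suc b) l) (- r)} (λ m m≤n → term m (ℕ.≤-pred m≤n)))
        where
        term : ∀ m → m ℕ.≤ n →
          + (q ℕ.^ (suc v ℕ.+ T)) ∣ newton-coeff q n m * act (Δ ^ˢ m) (U (q ℕ.^ suc b) l) (- r)
        term m m≤n = ∣-trans (^-∣-mono q exponent)
          (subst (_∣ newton-coeff q n m * act (Δ ^ˢ m) (U (q ℕ.^ suc b) l) (- r))
            (sym (+-pow-+ q (suc v ℕ.+ g) (T ℕ.∸ g)))
            (∣-*-mono (newton-coeff-div m d g m+d g<) (diff T-bound)))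
          where
          d g : ℕ
          d = proj₁ (ℕ.m≤n⇒∃[o]m+o≡n m≤n)
          g = proj₁ (ceiling p d)
          m+d : m ℕ.+ d ≡ n
          m+d = proj₂ (ℕ.m≤n⇒∃[o]m+o≡n m≤n)
          d≤ : d ℕ.≤ p ℕ.* g
          d≤ = proj₁ (proj₂ (ceiling p d))
          g< : p ℕ.* g ℕ.< d ℕ.+ p
          g< = proj₂ (proj₂ (ceiling p d))
          exponent : suc v ℕ.+ T ℕ.≤ suc v ℕ.+ g ℕ.+ (T ℕ.∸ g)
          exponent = ℕ.≤-trans (ℕ.+-monoʳ-≤ (suc v) (ℕ.m≤n+m∸n T g))
                       (ℕ.≤-reflexive (sym (ℕ.+-assoc (suc v) g (T ℕ.∸ g))))
          x : ℤ
          x = act (Δ ^ˢ m) (U (q ℕ.^ suc b) l) (- r)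
          none : T ℕ.≤ g → + (q ℕ.^ (T ℕ.∸ g)) ∣ x
          none T≤g = subst (λ t → + (q ℕ.^ t) ∣ x) (sym (ℕ.m≤n⇒m∸n≡0 T≤g)) (divides x (sym (ℤ.*-identityʳ x)))
          diff : T ≡ 0 ⊎ q ℕ.^ b ℕ.* p ℕ.* T ℕ.+ q ℕ.^ b ℕ.+ l ℕ.* q ℕ.^ suc b ℕ.≤ n → + (q ℕ.^ (T ℕ.∸ g)) ∣ x
          diff (inj₁ T≡0) = none (subst (ℕ._≤ g) (sym T≡0) z≤n)
          diff (inj₂ T≤) with T ℕ.≤? g
          ... | yes T≤g = none T≤g
          -- Lowering T by g frees e g ≥ p g ≥ d in the size condition, which covers the gap between
          -- m and n.
          ... | no  T≰g = Δ^-div pr b l (T ℕ.∸ g) m (ℕ.+-cancelʳ-≤ d _ m (begin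
            e ℕ.* (T ℕ.∸ g) ℕ.+ q ℕ.^ b ℕ.+ l ℕ.* q ℕ.^ suc b ℕ.+ d
              ≤⟨ ℕ.+-monoʳ-≤ (e ℕ.* (T ℕ.∸ g) ℕ.+ q ℕ.^ b ℕ.+ l ℕ.* q ℕ.^ suc b) (ℕ.≤-trans d≤ (ℕ.*-monoˡ-≤ g p≤e)) ⟩
            e ℕ.* (T ℕ.∸ g) ℕ.+ q ℕ.^ b ℕ.+ l ℕ.* q ℕ.^ suc b ℕ.+ e ℕ.* g
              ≡⟨ lem e (T ℕ.∸ g) (q ℕ.^ b) (l ℕ.* q ℕ.^ suc b) g ⟩
            e ℕ.* (T ℕ.∸ g ℕ.+ g) ℕ.+ q ℕ.^ b ℕ.+ l ℕ.* q ℕ.^ suc b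
              ≡⟨ cong (λ t → e ℕ.* t ℕ.+ q ℕ.^ b ℕ.+ l ℕ.* q ℕ.^ suc b) (ℕ.m∸n+n≡m (ℕ.<⇒≤ (ℕ.≰⇒> T≰g))) ⟩
            e ℕ.* T ℕ.+ q ℕ.^ b ℕ.+ l ℕ.* q ℕ.^ suc b
              ≤⟨ T≤ ⟩
            n
              ≡⟨ m+d ⟨
            m ℕ.+ d ∎)) (- r)
            where
            open ℕ.≤-Reasoning
            e : ℕ
            e = q ℕ.^ b ℕ.* p
            p≤e : p ℕ.≤ e
            p≤e = ℕ.m≤n*m p (q ℕ.^ b) {{ℕ.m^n≢0 q b}}
            lem : ∀ e t a c g → e ℕ.* t ℕ.+ a ℕ.+ c ℕ.+ e ℕ.* g ≡ e ℕ.* (t ℕ.+ g) ℕ.+ a ℕ.+ c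
            lem = ℕ-Ring.solve-∀

  -- From bracket sums to brackets.

  scaleNegPow-diff-∣ : ∀ q .{{_ : NonZero q}} k e {S₁ S₂} →
    (∀ T → T ≡ 0 ⊎ e ≡ + T → + (q ℕ.^ (k ℕ.+ T)) ∣ S₁ - S₂) →
    (∀ T → e ≡ + T → + (q ℕ.^ T) ∣ S₁) → (∀ T → e ≡ + T → + (q ℕ.^ T) ∣ S₂) →
    + (q ℕ.^ k) ∣ scaleNegPow q e S₁ - scaleNegPow q e S₂
  scaleNegPow-diff-∣ q k (+ T) {S₁} {S₂} d d₁ d₂ =
    *-cancelʳ-∣ (+ (q ℕ.^ T)) {{ℕ.m^n≢0 q T}}
      (subst (_∣ (floorDiv S₁ (q ℕ.^ T) - floorDiv S₂ (q ℕ.^ T)) * + (q ℕ.^ T)) (+-pow-+ q k T)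
        (subst (+ (q ℕ.^ (k ℕ.+ T)) ∣_) (sym exact) (d T (inj₂ refl))))
    where
    lem : ∀ a b c → (a - b) * c ≡ a * c - b * c
    lem = ℤ-Ring.solve-∀
    exact : (floorDiv S₁ (q ℕ.^ T) - floorDiv S₂ (q ℕ.^ T)) * + (q ℕ.^ T) ≡ S₁ - S₂
    exact = trans (lem (floorDiv S₁ (q ℕ.^ T)) (floorDiv S₂ (q ℕ.^ T)) (+ (q ℕ.^ T)))
      (cong₂ _-_ (floorDiv-exact (q ℕ.^ T) {{ℕ.m^n≢0 q T}} (d₁ T refl))
                 (floorDiv-exact (q ℕ.^ T) {{ℕ.m^n≢0 q T}} (d₂ T refl)))
  scaleNegPow-diff-∣ q k -[1+ m ] {S₁} {S₂} d d₁ d₂ =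
    subst (+ (q ℕ.^ k) ∣_) (lem S₁ S₂ (+ (q ℕ.^ suc m)))
      (∣m⇒∣m*n (+ (q ℕ.^ suc m)) (subst (λ j → + (q ℕ.^ j) ∣ S₁ - S₂) (ℕ.+-identityʳ k) (d 0 (inj₁ refl))))
    where
    lem : ∀ a b c → (a - b) * c ≡ a * c - b * c
    lem = ℤ-Ring.solve-∀

  bracketExponent : ℕ → ℕ → ℕ → ℕ → ℤ
  bracketExponent p b l n =
    floorDiv (+ n - + (p ℕ.^ (b ℕ.∸ 1)) - + (l ℕ.* p ℕ.^ b)) (totient (p ℕ.^ b))

  module _ {p : ℕ} .{{_ : NonZero p}} (pr : Prime (suc p)) where

    private
      q : ℕ
      q = suc p

    module _ (b l n : ℕ) where

      private
        φ : ℕ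
        φ = q ℕ.^ b ℕ.* p
        instance
          φ≢0 : NonZero φ
          φ≢0 = ℕ.m*n≢0 (q ℕ.^ b) p {{ℕ.m^n≢0 q b}}
        x : ℤ
        x = + n - + (q ℕ.^ b) - + (l ℕ.* q ℕ.^ suc b)

      bracketExponent-φ : bracketExponent q (suc b) l n ≡ floorDiv x φ
      bracketExponent-φ = cong (floorDiv x) (totient-prime-power pr b)

      bracketExponent-≤ : ∀ {T} → bracketExponent q (suc b) l n ≡ + T →
                          φ ℕ.* T ℕ.+ q ℕ.^ b ℕ.+ l ℕ.* q ℕ.^ suc b ℕ.≤ n
      bracketExponent-≤ {T} e≡ = ℤ.drop‿+≤+ (begin
        + (φ ℕ.* T ℕ.+ q ℕ.^ b ℕ.+ l ℕ.* q ℕ.^ suc b)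
          ≡⟨ cong (λ y → y + + (q ℕ.^ b) + + (l ℕ.* q ℕ.^ suc b)) (trans (cong +_ (ℕ.*-comm φ T)) (ℤ.pos-* T φ)) ⟩
        + T * + φ + + (q ℕ.^ b) + + (l ℕ.* q ℕ.^ suc b)
          ≡⟨ cong (λ y → y * + φ + + (q ℕ.^ b) + + (l ℕ.* q ℕ.^ suc b)) (trans (sym e≡) bracketExponent-φ) ⟩
        floorDiv x φ * + φ + + (q ℕ.^ b) + + (l ℕ.* q ℕ.^ suc b)
          ≤⟨ ℤ.+-monoˡ-≤ (+ (l ℕ.* q ℕ.^ suc b)) (ℤ.+-monoˡ-≤ (+ (q ℕ.^ b)) (floorDiv-*≤ φ x)) ⟩
        x + + (q ℕ.^ b) + + (l ℕ.* q ℕ.^ suc b)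
          ≡⟨ lem (+ n) (+ (q ℕ.^ b)) (+ (l ℕ.* q ℕ.^ suc b)) ⟩
        + n ∎)
        where
        open ℤ.≤-Reasoning
        lem : ∀ a b c → a - b - c + b + c ≡ a
        lem = ℤ-Ring.solve-∀

      -- Passing to b + 1 and q n multiplies both the numerator and the totient by q, so the floor
      -- does not change.
      bracketExponent-rescale : bracketExponent q (suc (suc b)) l (q ℕ.* n) ≡ bracketExponent q (suc b) l n
      bracketExponent-rescale = begin
        bracketExponent q (suc (suc b)) l (q ℕ.* n)
          ≡⟨ cong₂ floorDiv x-rescale (trans (totient-prime-power pr (suc b)) (ℕ.*-assoc q (q ℕ.^ b) p)) ⟩
        floorDiv (+ q * x) (q ℕ.* φ)
          ≡⟨ floorDiv-scale q φ x ⟩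
        floorDiv x φ
          ≡⟨ bracketExponent-φ ⟨
        bracketExponent q (suc b) l n ∎
        where
        open ≡-Reasoning
        x-rescale : + (q ℕ.* n) - + (q ℕ.^ suc b) - + (l ℕ.* q ℕ.^ suc (suc b)) ≡ + q * x
        x-rescale = trans
          (cong₂ _-_ (cong₂ _-_ (ℤ.pos-* q n) (ℤ.pos-* q (q ℕ.^ b)))
            (trans (cong +_ (lem₁ l q (q ℕ.^ suc b))) (ℤ.pos-* q (l ℕ.* q ℕ.^ suc b))))
          (lem₂ (+ q) (+ n) (+ (q ℕ.^ b)) (+ (l ℕ.* q ℕ.^ suc b)))
          where
          lem₁ : ∀ l q Q → l ℕ.* (q ℕ.* Q) ≡ q ℕ.* (l ℕ.* Q)
          lem₁ = ℕ-Ring.solve-∀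
          lem₂ : ∀ q a b c → q * a - q * b - q * c ≡ q * (a - b - c)
          lem₂ = ℤ-Ring.solve-∀

    bracket-diff-div : ∀ b l n .{{_ : NonZero n}} r w v → + (q ℕ.^ w) ∣ + n →
      q ℕ.* v ℕ.< p ℕ.* (2 ℕ.* w ℕ.+ δ q) →
      + (q ℕ.^ suc v) ∣ bracket q (suc (suc b)) l (q ℕ.* n) (+ q * r) - bracket q (suc b) l n r
    bracket-diff-div b l n r w v q^w∣n v< =
      subst (λ e → + (q ℕ.^ suc v) ∣ scaleNegPow q e S₁ - scaleNegPow q (bracketExponent q (suc b) l n) S₂)
        (sym (bracketExponent-rescale b l n))
        (scaleNegPow-diff-∣ q (suc v) (bracketExponent q (suc b) l n)
          (λ { T (inj₁ T≡0) → bracketSum-diff-div pr n w v q^w∣n v< b l r T (inj₁ T≡0)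
             ; T (inj₂ e≡)  → bracketSum-diff-div pr n w v q^w∣n v< b l r T (inj₂ (bracketExponent-≤ b l n e≡)) })
          (λ T e≡ → bracketSum-div pr (suc b) l T (q ℕ.* n) (+ q * r) (scaled T (bracketExponent-≤ b l n e≡)))
          (λ T e≡ → bracketSum-div pr b l T n r (bracketExponent-≤ b l n e≡)))
      where
      S₁ S₂ : ℤ
      S₁ = bracketSum q (suc (suc b)) l (q ℕ.* n) (+ q * r)
      S₂ = bracketSum q (suc b) l n r
      scaled : ∀ T → q ℕ.^ b ℕ.* p ℕ.* T ℕ.+ q ℕ.^ b ℕ.+ l ℕ.* q ℕ.^ suc b ℕ.≤ n →
               q ℕ.^ suc b ℕ.* p ℕ.* T ℕ.+ q ℕ.^ suc b ℕ.+ l ℕ.* q ℕ.^ suc (suc b) ℕ.≤ q ℕ.* n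
      scaled T ≤n = ℕ.≤-trans (ℕ.≤-reflexive (lem q (q ℕ.^ b) p T l)) (ℕ.*-monoʳ-≤ q ≤n)
        where
        lem : ∀ q P p T l → q ℕ.* P ℕ.* p ℕ.* T ℕ.+ q ℕ.* P ℕ.+ l ℕ.* (q ℕ.* (q ℕ.* P))
            ≡ q ℕ.* (P ℕ.* p ℕ.* T ℕ.+ P ℕ.+ l ℕ.* (q ℕ.* P))
        lem = ℕ-Ring.solve-∀

open import Data.Nat using (ℕ; suc; _+_; _∸_; _≤_)
open import Data.Nat using () renaming (_*_ to _*ℕ_)
open import Data.Integer using (ℤ; +_; _-_; _*_)

theorem1p4 : (p : ℕ) → Prime p → (a n : ℕ) → 1 ≤ a → 1 ≤ n → (l : ℕ) → (r : ℤ) →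
    (w v : ℕ) → IsOrd p (+ n) w →
    IsOrd p (bracket p (suc a) l (p *ℕ n) (+ p * r) - bracket p a l n r) v →
    (p ∸ 1) *ℕ (2 *ℕ w + δ p) ≤ p *ℕ v
theorem1p4 zero                 pr = ⊥-elim (¬prime[0] pr)
theorem1p4 (suc zero)           pr = ⊥-elim (¬prime[1] pr)
theorem1p4 (suc p@(suc _)) pr (suc b) n@(suc _) _ _ l r w v (q^w∣n , _) (_ , q^1+v∤) =
  ℕ.≮⇒≥ (λ v< → q^1+v∤ (∣⇒∣ᵤ (BracketDivisibility.bracket-diff-div pr b l n r w v (∣ᵤ⇒∣ q^w∣n) v<)))
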